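{- Let $\Sigma=(B,\sigma)$ be a signed graph whose underlying graph $B$ is a block that is neither a single edge nor a circle, and suppose $[e,C,+]$ is a positive battery and $C$ has exactly two bridges $D_1,D_2$. If both $D_1$ and $D_2$ are paths, then every edge of $D_1\cup D_2$ is a positive battery. Otherwise, no edge of $D_1\cup D_2$ is a positive battery.
   Context: A signed graph $\Sigma=(G,\sigma)$ is a finite graph $G$ with signature $\sigma:E(G)\to\{+,-\}$. A circle is a connected 2-regular subgraph; its sign is the product of its edge signs. A block is a maximal subgraph without a cutpoint. For a circle $C$, a chord is an edge not in $C$ joining two distinct vertices of $C$; a bridge of $C$ is either a chord or a connected component $D$ of $G\setminus V(C)$ together with all edges joining $D$ to $C$ (a bridge "is a path" if as a subgraph it is a path). An edge $f$ is a positive battery if it lies in exactly one positive circle; $[e,C,+]$ means $C$ is a positive circle containing $e$ and is the only positive circle containing $e$. -}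

module Defs where

open import Algebra.Properties.CommutativeMonoid.Sum using (sum)
open import Data.Bool using (if_then_else_)
open import Data.Fin using (Fin; suc; inject₁)
open import Data.Fin.Subset using (Subset; _∈_; _∉_; _⊆_; _∪_; _∩_; ∁; ⊤; ⁅_⁆; Nonempty; ∣_∣)
open import Data.Fin.Subset.Properties using (∈⊤; x∈p∩q⁺; x∈p∩q⁻)
open import Data.Nat using (ℕ; _+_)
open import Data.Product using (Σ-syntax; ∃-syntax; _×_; _,_; proj₁; proj₂)
open import Data.Sign using (Sign)
import Data.Sign.Properties as Sign
open import Data.Sum using (_⊎_)
open import Data.Vec using (lookup; tabulate)
open import Data.Vec.Properties using (lookup∘tabulate; []=⇒lookup; lookup⇒[]=)
open import Function.Bundles using (_⇔_)
open import Function.Definitions using (Injective)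
open import Relation.Binary.Construct.Closure.ReflexiveTransitive using (Star)
open import Relation.Binary.PropositionalEquality using (_≡_; _≢_; sym; trans)
open import Relation.Nullary using (¬_)

-- Loops and parallel edges are allowed.  The order of the two ends of an edge
-- carries no meaning; every notion below is symmetric in them.
record Graph : Set where
  field
    order size : ℕ
    end₁ end₂  : Fin size → Fin order

  Vertex Edge : Set
  Vertex = Fin order
  Edge   = Fin size

  Joins : Edge → Vertex → Vertex → Set
  Joins e u v = (end₁ e ≡ u × end₂ e ≡ v) ⊎ (end₁ e ≡ v × end₂ e ≡ u)

  Incident : Edge → Vertex → Set
  Incident e v = end₁ e ≡ v ⊎ end₂ e ≡ v

record SignedGraph : Set where
  field
    graph : Graph
  open Graph graph public
  field
    σ : Edge → Sign

preimage : ∀ {m n} → (Fin m → Fin n) → Subset n → Subset m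
preimage f S = tabulate (λ i → lookup S (f i))

∈-preimage⁻ : ∀ {m n} (f : Fin m → Fin n) S {i} → i ∈ preimage f S → f i ∈ S
∈-preimage⁻ f S {i} p =
  lookup⇒[]= (f i) S
    (trans (sym (lookup∘tabulate (λ j → lookup S (f j)) i)) ([]=⇒lookup p))

module _ (G : Graph) where
  open Graph G

  record Subgraph : Set where
    field
      V      : Subset order
      E      : Subset size
      closed : ∀ {e} → e ∈ E → end₁ e ∈ V × end₂ e ∈ V

  whole : Subgraph
  whole = record { V = ⊤ ; E = ⊤ ; closed = λ _ → ∈⊤ , ∈⊤ }

open Subgraph public

module _ {G : Graph} where
  open Graph G

  infix 4 _⊑_ _≐_

  _⊑_ : Subgraph G → Subgraph G → Set
  H ⊑ K = V H ⊆ V K × E H ⊆ E K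

  -- Equality of subgraphs: the proof field `closed` is disregarded.
  _≐_ : Subgraph G → Subgraph G → Set
  H ≐ K = V H ≡ V K × E H ≡ E K

  infixl 6 _∖_

  -- Deletion of a set of vertices together with all edges incident to it.
  _∖_ : Subgraph G → Subset order → Subgraph G
  H ∖ S = record
    { V      = V H ∩ ∁ S
    ; E      = E H ∩ (preimage end₁ (∁ S) ∩ preimage end₂ (∁ S))
    ; closed = λ p →
        let (eH , q)  = x∈p∩q⁻ (E H) _ p
            (q₁ , q₂) = x∈p∩q⁻ (preimage end₁ (∁ S)) _ q
            (v₁ , v₂) = closed H eH
        in x∈p∩q⁺ (v₁ , ∈-preimage⁻ end₁ (∁ S) q₁)
         , x∈p∩q⁺ (v₂ , ∈-preimage⁻ end₂ (∁ S) q₂)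
    }

  Adjacent : Subgraph G → Vertex → Vertex → Set
  Adjacent H u v = ∃[ e ] e ∈ E H × Joins e u v

  Reachable : Subgraph G → Vertex → Vertex → Set
  Reachable H = Star (Adjacent H)

  Connected : Subgraph G → Set
  Connected H =
    Nonempty (V H) × (∀ {u v} → u ∈ V H → v ∈ V H → Reachable H u v)

  IsComponent : Subgraph G → Subgraph G → Set
  IsComponent H D =
    D ⊑ H × Connected D × (∀ K → K ⊑ H → Connected K → D ⊑ K → K ⊑ D)

  -- A loop contributes 2.
  degree : Subgraph G → Vertex → ℕ
  degree H v = ∣ E H ∩ preimage end₁ ⁅ v ⁆ ∣ + ∣ E H ∩ preimage end₂ ⁅ v ⁆ ∣

  IsCircle : Subgraph G → Set
  IsCircle H = Connected H × (∀ {v} → v ∈ V H → degree H v ≡ 2)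

  IsPath : Subgraph G → Set
  IsPath H =
    ∃[ k ] Σ[ v ∈ (Fin (ℕ.suc k) → Vertex) ] Σ[ ε ∈ (Fin k → Edge) ]
      Injective _≡_ _≡_ v
      × (∀ i → Joins (ε i) (v (inject₁ i)) (v (suc i)))
      × (∀ x → x ∈ V H ⇔ (∃[ i ] v i ≡ x))
      × (∀ f → f ∈ E H ⇔ (∃[ i ] ε i ≡ f))

  -- The subgraph consisting of the edge e and its ends u and v.
  IsEdgeJoining : Edge → Vertex → Vertex → Subgraph G → Set
  IsEdgeJoining e u v H = Joins e u v × V H ≡ ⁅ u ⁆ ∪ ⁅ v ⁆ × E H ≡ ⁅ e ⁆

  IsSingleEdge : Subgraph G → Set
  IsSingleEdge H = ∃[ e ] ∃[ u ] ∃[ v ] IsEdgeJoining e u v H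

  -- The first alternative says that deleting v increases the number of
  -- components.  The second is the usual convention for graphs with loops: a
  -- vertex carrying a loop separates it from every other edge at that vertex, so
  -- that a loop is always a block by itself.
  IsCutpoint : Subgraph G → Vertex → Set
  IsCutpoint H v = v ∈ V H ×
    ( (∃[ u ] ∃[ w ] u ∈ V (H ∖ ⁅ v ⁆) × w ∈ V (H ∖ ⁅ v ⁆)
         × Reachable H u w × ¬ Reachable (H ∖ ⁅ v ⁆) u w)
    ⊎ (∃[ l ] ∃[ f ] l ∈ E H × Joins l v v × f ∈ E H × Incident f v × f ≢ l) )

  NoCutpoint : Subgraph G → Set
  NoCutpoint H = ∀ v → ¬ IsCutpoint H v

  IsBlock : Subgraph G → Set
  IsBlock H = Connected H × NoCutpoint H
    × (∀ K → Connected K → NoCutpoint K → H ⊑ K → K ⊑ H)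

  JoinsTo : Subgraph G → Subgraph G → Edge → Set
  JoinsTo D C f = ∃[ u ] ∃[ v ] u ∈ V D × v ∈ V C × Joins f u v

  -- Bridges are subgraphs, so they contain their vertices of attachment on C.
  data IsBridge (C B : Subgraph G) : Set where
    chord     : ∀ {e u v} → e ∉ E C → u ≢ v → u ∈ V C → v ∈ V C →
                IsEdgeJoining e u v B → IsBridge C B
    component : ∀ {D} → IsComponent (whole G ∖ V C) D →
                (∀ f → f ∈ E B ⇔ (f ∈ E D ⊎ JoinsTo D C f)) →
                (∀ x → x ∈ V B ⇔
                  (x ∈ V D ⊎ (∃[ f ] JoinsTo D C f × Incident f x))) →
                IsBridge C B

  HasExactlyTwoBridges : (C D₁ D₂ : Subgraph G) → Set
  HasExactlyTwoBridges C D₁ D₂ =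
    IsBridge C D₁ × IsBridge C D₂ × ¬ (D₁ ≐ D₂)
    × (∀ D → IsBridge C D → D ≐ D₁ ⊎ D ≐ D₂)

module _ (Γ : SignedGraph) where
  open SignedGraph Γ

  -- `sum` in the multiplicative monoid of signs, i.e. a product.
  sign : Subgraph graph → Sign
  sign H = sum Sign.*-commutativeMonoid
    (λ e → if lookup (E H) e then σ e else Sign.+)

  IsPositiveCircle : Subgraph graph → Set
  IsPositiveCircle C = IsCircle C × sign C ≡ Sign.+

  -- [ e , C , + ]
  IsPositiveBatteryIn : Edge → Subgraph graph → Set
  IsPositiveBatteryIn e C = IsPositiveCircle C × e ∈ E C
    × (∀ C′ → IsPositiveCircle C′ → e ∈ E C′ → C′ ≐ C)

  IsPositiveBattery : Edge → Set
  IsPositiveBattery e = ∃[ C ] IsPositiveBatteryIn e C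

{-# OPTIONS --safe #-}
-- Edge sets are vectors over 𝔽₂; circles are the minimal nonempty members of the cycle space of G, and
-- bridges of C are studied through the cycle space of G / C.  Call a minimal cycle X of G / C an ear if it
-- is not a cycle of G, that is, if it is a path between distinct vertices of C.  The cycle LX of G over X
-- through e is a circle other than C, hence negative.  It follows that three ears never sum to zero, and
-- that LX ⊕ LY is a positive circle when X and Y are ears in different bridges: the only alternatives
-- would give a positive circle LX ⊕ LY ⊕ C through e.  If a bridge is larger than an ear X inside it, then
-- X lies in a theta graph of G / C, which provides another ear and with it a second positive circle
-- through any given edge of the two bridges.  So a battery outside C forces both bridges to be single
-- ears, which are paths; and if they are, LX ⊕ LY is the only positive circle through each of their edges.
module Submission where

open import Algebra.Bundles using (CommutativeRing)
import Algebra.Properties.CommutativeMonoid.Sum as CMSum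
import Algebra.Properties.Semiring.Sum as SRSum
open import Data.Bool using (Bool; true; false; _∧_; _∨_; not; _xor_; if_then_else_)
import Data.Bool.Properties as Bool
open import Data.Bool.Solver using (module xor-∧-Solver)
open import Data.Empty using (⊥; ⊥-elim)
open import Data.Fin using (Fin; zero; suc; toℕ; inject₁; fromℕ)
open import Data.Fin.Properties using (_≟_; all?; any?; toℕ<n; toℕ-injective; inject₁-injective; suc-injective; toℕ-inject₁)
open import Data.Fin.Subset using (Subset; _∈_; _∉_; ⁅_⁆; ∣_∣; _∩_; _∪_; ∁)
open import Data.Fin.Subset.Properties using (_∈?_; anySubset?; x∈⁅y⁆⇒x≡y; x∈⁅x⁆; x∈p∩q⁺; x∈p∩q⁻; x∈∁p⇒x∉p; x∉p⇒x∈∁p; x∈p∪q⁺; x∈p∪q⁻; ∪-comm; ⊆-antisym; ∈⊤)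
open import Data.Nat using (ℕ; zero; suc; _+_; _*_; _<_; _<?_; _≤_; z≤n; s≤s)
open import Data.Nat.Induction using (<-wellFounded)
import Data.Nat.Properties as ℕ
open import Data.Product using (∃-syntax; _×_; _,_; proj₁; proj₂)
open import Data.Sign using (Sign) renaming (_*_ to _·_; + to ⊹; - to ⊖)
import Data.Sign.Properties as Sign
import Data.Sum as Sum
open import Data.Sum using (_⊎_; inj₁; inj₂; swap)
open import Data.Vec using (lookup; tabulate; []; _∷_)
open import Data.Vec.Properties using (lookup∘tabulate; lookup-zipWith; []=⇒lookup; lookup⇒[]=)
open import Function using (_∘_)
open import Function.Bundles using (_⇔_; mk⇔; Equivalence)
open import Function.Definitions using (Injective)
open import Induction.WellFounded using (Acc; acc)
open import Relation.Binary.Construct.Closure.ReflexiveTransitive using (Star; ε; _◅_; _◅◅_)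
open import Relation.Binary.PropositionalEquality using (_≡_; _≢_; _≗_; refl; sym; trans; cong; cong₂; subst)
open import Relation.Nullary using (¬_; Dec; yes; no; does; ¬?; _×-dec_; _⊎-dec_; _→-dec_; map′)
open import Relation.Nullary.Decidable using (dec-true; dec-false)
open import Relation.Unary using (Decidable)
open import Defs
open xor-∧-Solver using (solve; _:+_; _:=_)

-- Subspaces of 𝔽₂ᵐ and their circuits

-- The obstacle is that LX ⊕ LY may fall apart into two circles, depending on how the feet of the
-- two ears are placed around C and on which arc holds e. No order of vertices on C is ever
-- compared. Restriction off C maps the cycles of G onto those of G / C with kernel ∅ and C, so over
-- every X there are exactly two cycles, one of them through e, and they have the same sign because
-- C is positive. A cycle is thus determined by its part off C and its value at e, and every bad
-- placement is excluded by identifying such cycles and comparing signs. That argument is written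
-- for two binary subspaces without vertices. The graph re-enters to show that circles are circuits,
-- that bridges are separators of G / C, and that a bridge is a path exactly when it is a circuit
-- there. Subsets are Boolean functions compared pointwise, so predicates carry closure under `≗`,
-- and minimal choices are made by exhaustive search.

true≢false : true ≢ false
true≢false ()

absurdᵇ : ∀ {a} {A : Set a} {b : Bool} → b ≡ true → b ≡ false → A
absurdᵇ p q = ⊥-elim (true≢false (trans (sym p) q))

𝔽 : ℕ → Set
𝔽 m = Fin m → Bool

module _ {m : ℕ} where

  infixl 7 _∖ᶠ_
  infixl 6 _⊕_
  infix  4 _⊆ᶠ_

  ∅ : 𝔽 m
  ∅ _ = false

  _⊕_ _∖ᶠ_ : 𝔽 m → 𝔽 m → 𝔽 m
  (X ⊕ Y) i = X i xor Y i
  (X ∖ᶠ Y) i = X i ∧ not (Y i)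

  _⊆ᶠ_ : 𝔽 m → 𝔽 m → Set
  X ⊆ᶠ Y = ∀ i → X i ≡ true → Y i ≡ true

  Inhabited : 𝔽 m → Set
  Inhabited X = ∃[ i ] X i ≡ true

  ⊆-antisymᶠ : {X Y : 𝔽 m} → X ⊆ᶠ Y → Y ⊆ᶠ X → X ≗ Y
  ⊆-antisymᶠ {X} {Y} p q i with X i | Y i | p i | q i
  ... | true  | true  | _ | _ = refl
  ... | false | false | _ | _ = refl
  ... | true  | false | p | _ = sym (p refl)
  ... | false | true  | _ | q = q refl

  ⊕-⊆ : {X Y : 𝔽 m} → Y ⊆ᶠ X → X ⊕ Y ⊆ᶠ X
  ⊕-⊆ {X} {Y} Y⊆X i p with X i | Y i | Y⊆X i
  ... | true  | _    | _ = refl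
  ... | false | true | q = q refl

  _⊆ᶠ?_ : ∀ X Y → Dec (X ⊆ᶠ Y)
  X ⊆ᶠ? Y = all? λ i → (X i Bool.≟ true) →-dec (Y i Bool.≟ true)

  _≗?_ : ∀ (X Y : 𝔽 m) → Dec (X ≗ Y)
  X ≗? Y = all? λ i → X i Bool.≟ Y i

  ≗-sym : {X Y : 𝔽 m} → X ≗ Y → Y ≗ X
  ≗-sym p i = sym (p i)

  ⊕≗∅⇒≗ : ∀ (X Y : 𝔽 m) → X ⊕ Y ≗ ∅ → X ≗ Y
  ⊕≗∅⇒≗ X Y p i with X i | Y i | p i
  ... | false | false | _ = refl
  ... | true  | true  | _ = refl

  ⊆-∨-false : {X Y : 𝔽 m} → X ⊆ᶠ Y → ∀ i → Y i ≡ false → X i ≡ false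
  ⊆-∨-false {X} X⊆Y i q with X i in eq
  ... | false = refl
  ... | true  = absurdᵇ (X⊆Y i eq) q

card : ∀ {m} → 𝔽 m → ℕ
card {zero}  X = 0
card {suc m} X with X zero
... | true  = suc (card (X ∘ suc))
... | false = card (X ∘ suc)

card-cong : ∀ {m} {X Y : 𝔽 m} → X ≗ Y → card X ≡ card Y
card-cong {zero}  p = refl
card-cong {suc m} {X} {Y} p with X zero | Y zero | p zero
... | true  | _ | refl = cong suc (card-cong (p ∘ suc))
... | false | _ | refl = card-cong (p ∘ suc)

card-mono : ∀ {m} {X Y : 𝔽 m} → X ⊆ᶠ Y → card X ≤ card Y
card-mono {zero}  p = z≤n
card-mono {suc m} {X} {Y} p with X zero | Y zero | p zero
... | true  | true  | _ = s≤s (card-mono (p ∘ suc))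
... | true  | false | q = absurdᵇ (q refl) refl
... | false | true  | _ = ℕ.m≤n⇒m≤1+n (card-mono (p ∘ suc))
... | false | false | _ = card-mono (p ∘ suc)

card-strict : ∀ {m} {X Y : 𝔽 m} → X ⊆ᶠ Y → ∀ j → Y j ≡ true → X j ≡ false → card X < card Y
card-strict {suc m} {X} {Y} p zero yj xj with X zero | Y zero
... | false | true = s≤s (card-mono (p ∘ suc))
card-strict {suc m} {X} {Y} p (suc j) yj xj with X zero | Y zero | p zero
... | true  | true  | _ = s≤s (card-strict (p ∘ suc) j yj xj)
... | true  | false | q = absurdᵇ (q refl) refl
... | false | true  | _ = ℕ.m<n⇒m<1+n (card-strict (p ∘ suc) j yj xj)
... | false | false | _ = card-strict (p ∘ suc) j yj xj

-- Turns the negative conclusion of `minimal` into an inclusion.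
⊆-card≮⇒⊇ : ∀ {m} {X Y : 𝔽 m} → X ⊆ᶠ Y → ¬ (card X < card Y) → Y ⊆ᶠ X
⊆-card≮⇒⊇ {X = X} X⊆Y ≮ i yi with X i in eq
... | true  = refl
... | false = ⊥-elim (≮ (card-strict X⊆Y i yi eq))

module _ {m : ℕ} {P : 𝔽 m → Set} (P? : Decidable P) (P-resp : ∀ {X Y} → X ≗ Y → P X → P Y) where

  -- Reduced to a search over vectors; `P-resp` bridges the gap, since `lookup` after `tabulate`
  -- gives X back only pointwise.
  any𝔽? : Dec (∃[ X ] P X)
  any𝔽? with anySubset? (λ S → P? (lookup S))
  ... | yes (S , p) = yes (lookup S , p)
  ... | no ¬p = no λ (X , p) → ¬p (tabulate X , P-resp (≗-sym (lookup∘tabulate X)) p)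

module _ {m : ℕ} {P : 𝔽 m → Set} (P? : Decidable P) (P-resp : ∀ {X Y} → X ≗ Y → P X → P Y)
         (μ : 𝔽 m → ℕ) (μ-resp : ∀ {X Y} → X ≗ Y → μ X ≡ μ Y) where

  abstract
    -- The measure is left general because `theta` minimises the part of Y outside X rather than the
    -- size of Y.
    minimal : ∃[ X ] P X → ∃[ X ] P X × (∀ Y → P Y → ¬ (μ Y < μ X))
    minimal (X , p) = go X p (<-wellFounded (μ X))
      where
      go : ∀ X → P X → Acc _<_ (μ X) → ∃[ X ] P X × (∀ Y → P Y → ¬ (μ Y < μ X))
      go X p (acc rec) with any𝔽? (λ Y → P? Y ×-dec (μ Y <? μ X))
                              (λ eq (q , lt) → P-resp eq q , subst (_< μ X) (μ-resp eq) lt)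
      ... | yes (Y , q , lt) = go Y q (rec lt)
      ... | no ¬smaller = X , p , λ Y q lt → ¬smaller (Y , q , lt)

-- Over the two-element field, closure under sums together with the zero vector is all of linearity.
record Subspace (m : ℕ) : Set₁ where
  field
    Mem    : 𝔽 m → Set
    Mem?   : Decidable Mem
    ⊕-mem  : ∀ {X Y} → Mem X → Mem Y → Mem (X ⊕ Y)
    resp   : ∀ {X Y} → X ≗ Y → Mem X → Mem Y
    ∅-mem  : Mem ∅

module _ {m : ℕ} (𝒱 : Subspace m) where
  open Subspace 𝒱

  -- The circuits of the binary matroid with cycle space `𝒱`.
  Circuit : 𝔽 m → Set
  Circuit X = Mem X × Inhabited X × (∀ W → Mem W → W ⊆ᶠ X → W ≗ ∅ ⊎ W ≗ X)

  Circuit-resp : ∀ {X Y} → X ≗ Y → Circuit X → Circuit Y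
  Circuit-resp p (mX , (i , xi) , min) =
    resp p mX , (i , trans (sym (p i)) xi) , λ W mW W⊆Y → go W (min W mW λ i w → trans (p i) (W⊆Y i w))
    where
    go : ∀ W → W ≗ ∅ ⊎ W ≗ _ → W ≗ ∅ ⊎ W ≗ _
    go W (inj₁ q) = inj₁ q
    go W (inj₂ q) = inj₂ λ i → trans (q i) (p i)

  abstract
    circuit? : Decidable Circuit
    circuit? X with Mem? X | any? (λ i → X i Bool.≟ true)
                  | any𝔽? {P = λ W → Mem W × W ⊆ᶠ X × ¬ (W ≗ ∅) × ¬ (W ≗ X)}
                      (λ W → Mem? W ×-dec (W ⊆ᶠ? X) ×-dec ¬? (W ≗? ∅) ×-dec ¬? (W ≗? X))
                      (λ eq (a , b , c , d) → resp eq a , (λ i y → b i (trans (eq i) y))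
                         , (λ z → c λ i → trans (eq i) (z i)) , (λ z → d λ i → trans (eq i) (z i)))
    ... | no ¬m | _ | _ = no λ c → ¬m (proj₁ c)
    ... | yes _ | no ¬i | _ = no λ c → ¬i (proj₁ (proj₂ c))
    ... | yes _ | yes _ | yes (W , a , b , c , d) = no λ (_ , _ , min) → bad (min W a b)
      where
      bad : ¬ (W ≗ ∅ ⊎ W ≗ X)
      bad (inj₁ z) = c z
      bad (inj₂ z) = d z
    ... | yes p | yes q | no ¬v = yes (p , q , min)
      where
      min : ∀ W → Mem W → W ⊆ᶠ X → W ≗ ∅ ⊎ W ≗ X
      min W a b with W ≗? ∅ | W ≗? X
      ... | yes z | _     = inj₁ z
      ... | no _  | yes z = inj₂ z
      ... | no z  | no z′ = ⊥-elim (¬v (W , a , b , z , z′))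

  circuit-≗ : ∀ {X W i} → Circuit X → Mem W → W ⊆ᶠ X → W i ≡ true → W ≗ X
  circuit-≗ {i = i} (_ , _ , min) mW W⊆X wi with min _ mW W⊆X
  ... | inj₁ z = absurdᵇ wi (z i)
  ... | inj₂ z = z

  abstract
    -- A smallest member O through i works: for a member W inside O, either W or O ⊕ W passes
    -- through i, and by minimality that one is all of O.
    circuitIn : ∀ {X i} → Mem X → X i ≡ true → ∃[ O ] Circuit O × O ⊆ᶠ X × O i ≡ true
    circuitIn {X} {i} mX xi
      with minimal {P = λ Y → Mem Y × Y ⊆ᶠ X × Y i ≡ true}
             (λ Y → Mem? Y ×-dec (Y ⊆ᶠ? X) ×-dec (Y i Bool.≟ true))
             (λ eq (a , b , c) → resp eq a , (λ j y → b j (trans (eq j) y)) , trans (sym (eq i)) c)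
             card card-cong (X , mX , (λ _ z → z) , xi)
    ... | O , (mO , O⊆X , oi) , least = O , (mO , (i , oi) , min) , O⊆X , oi
      where
      min : ∀ W → Mem W → W ⊆ᶠ O → W ≗ ∅ ⊎ W ≗ O
      min W mW W⊆O with W i in wi
      ... | true  = inj₂ (⊆-antisymᶠ W⊆O O⊆W)
        where
        O⊆W : O ⊆ᶠ W
        O⊆W = ⊆-card≮⇒⊇ W⊆O (least W (mW , (λ j w → O⊆X j (W⊆O j w)) , wi))
      ... | false = inj₁ eq
        where
        O⊆O⊕W : O ⊆ᶠ O ⊕ W
        O⊆O⊕W = ⊆-card≮⇒⊇ (⊕-⊆ W⊆O)
          (least (O ⊕ W) (⊕-mem mO mW , (λ j w → O⊆X j (⊕-⊆ W⊆O j w)) , cong₂ _xor_ oi wi))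
        eq : W ≗ ∅
        eq j with W j in p
        ... | false = refl
        ... | true  = absurdᵇ (O⊆O⊕W j (W⊆O j p)) (cong₂ _xor_ (W⊆O j p) p)

  abstract
    -- The exchange of `circuitIn`, with lying outside `𝒲` in place of passing through i: if W is in
    -- `𝒲`, then O ⊕ W is not, as adding W again returns O. With `𝒲` the cycles of G this produces
    -- ears.
    circuitOutside : (𝒲 : Subspace m) → ∀ {X} → Mem X → ¬ Subspace.Mem 𝒲 X →
      ∃[ O ] Circuit O × O ⊆ᶠ X × ¬ Subspace.Mem 𝒲 O
    circuitOutside 𝒲 {X} mX X∉
      with minimal {P = λ Y → Mem Y × Y ⊆ᶠ X × ¬ 𝒲.Mem Y}
             (λ Y → Mem? Y ×-dec (Y ⊆ᶠ? X) ×-dec ¬? (𝒲.Mem? Y))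
             (λ eq (a , b , c) → resp eq a , (λ j y → b j (trans (eq j) y)) , λ w → c (𝒲.resp (≗-sym eq) w))
             card card-cong (X , mX , (λ _ z → z) , X∉)
      where module 𝒲 = Subspace 𝒲
    ... | O , (mO , O⊆X , O∉) , least = O , (mO , inhabited , min) , O⊆X , O∉
      where
      module 𝒲 = Subspace 𝒲
      cancel : ∀ a b → (a xor b) xor b ≡ a
      cancel a b = trans (Bool.xor-assoc a b b) (trans (cong (a xor_) (Bool.xor-same b)) (Bool.xor-identityʳ a))
      inhabited : Inhabited O
      inhabited with any? (λ i → O i Bool.≟ true)
      ... | yes p = p
      ... | no ¬p = ⊥-elim (O∉ (𝒲.resp (λ i → sym (Bool.¬-not λ o → ¬p (i , o))) 𝒲.∅-mem))
      min : ∀ W → Mem W → W ⊆ᶠ O → W ≗ ∅ ⊎ W ≗ O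
      min W mW W⊆O with 𝒲.Mem? W | any? (λ i → W i Bool.≟ true)
      ... | _      | no ¬w = inj₁ λ i → Bool.¬-not λ w → ¬w (i , w)
      ... | no W∉  | yes _ = inj₂ (⊆-antisymᶠ W⊆O O⊆W)
        where
        O⊆W : O ⊆ᶠ W
        O⊆W = ⊆-card≮⇒⊇ W⊆O (least W (mW , (λ j w → O⊆X j (W⊆O j w)) , W∉))
      ... | yes W∈ | yes (i , wi) = absurdᵇ (O⊆O⊕W i (W⊆O i wi)) (cong₂ _xor_ (W⊆O i wi) wi)
        where
        O⊆O⊕W : O ⊆ᶠ O ⊕ W
        O⊆O⊕W = ⊆-card≮⇒⊇ (⊕-⊆ W⊆O) (least (O ⊕ W) (⊕-mem mO mW , (λ j w → O⊆X j (⊕-⊆ W⊆O j w)) ,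
                  λ z → O∉ (𝒲.resp (λ j → cancel (O j) (W j)) (𝒲.⊕-mem z W∈))))

  -- Take Y with |Y \ X| minimal: a circuit in X ⊕ Y through h then agrees with Y outside X, so it is X ⊕ Y.
  abstract
    theta : ∀ {X Y g h} → Circuit X → Circuit Y →
            X g ≡ true → Y g ≡ true → X h ≡ false → Y h ≡ true →
            ∃[ Y′ ] Circuit Y′ × Circuit (X ⊕ Y′) × (∃[ i ] X i ≡ true × Y′ i ≡ true) × Y′ h ≡ true
    theta {X} {Y} {g} {h} cX cY xg yg xh yh
      with minimal {P = λ Y → Circuit Y × (∃[ i ] X i ≡ true × Y i ≡ true) × Y h ≡ true}
             (λ Y → circuit? Y ×-dec any? (λ i → (X i Bool.≟ true) ×-dec (Y i Bool.≟ true)) ×-dec (Y h Bool.≟ true))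
             (λ eq (a , (i , b , c) , d) → Circuit-resp eq a , (i , b , trans (sym (eq i)) c) , trans (sym (eq h)) d)
             (λ Y → card (Y ∖ᶠ X)) (λ eq → card-cong λ i → cong (_∧ not (X i)) (eq i))
             (Y , cY , (g , xg , yg) , yh)
    ... | Y , (cY , (i , xi , yi) , yh) , least
      with circuitIn (⊕-mem (proj₁ cX) (proj₁ cY)) (cong₂ _xor_ xh yh)
    ... | W , cW , W⊆ , wh = Y , cY , Circuit-resp W≗X⊕Y cW , (i , xi , yi) , yh
      where
      W∖X⊆ : W ∖ᶠ X ⊆ᶠ Y ∖ᶠ X
      W∖X⊆ j p with W j | X j | Y j | W⊆ j
      ... | true | false | true  | _ = refl
      ... | true | false | false | q = q refl
      -- W may compete with Y only if it meets X. Otherwise W would be a cycle inside the circuit Y,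
      -- hence Y itself, which meets X at i.
      meets : ∃[ j ] X j ≡ true × W j ≡ true
      meets with any? (λ j → (X j Bool.≟ true) ×-dec (W j Bool.≟ true))
      ... | yes p = p
      ... | no ¬p = ⊥-elim (¬p (i , xi , trans (circuit-≗ cY (proj₁ cW) W⊆Y wh i) yi))
        where
        W⊆Y : W ⊆ᶠ Y
        W⊆Y j wj with X j in xj | W⊆ j wj
        ... | true  | _ = ⊥-elim (¬p (j , xj , wj))
        ... | false | q = q
      Y∖X⊆ : Y ∖ᶠ X ⊆ᶠ W ∖ᶠ X
      Y∖X⊆ = ⊆-card≮⇒⊇ W∖X⊆ (least W (cW , meets , wh))
      W⊕Y⊆X : W ⊕ Y ⊆ᶠ X
      W⊕Y⊆X j p with W j | Y j | X j | W∖X⊆ j | Y∖X⊆ j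
      ... | true  | false | true  | _ | _ = refl
      ... | true  | false | false | q | _ = q refl
      ... | false | true  | true  | _ | _ = refl
      ... | false | true  | false | _ | q = q refl
      W≗X⊕Y : W ≗ X ⊕ Y
      W≗X⊕Y with proj₂ (proj₂ cX) (W ⊕ Y) (⊕-mem (proj₁ cW) (proj₁ cY)) W⊕Y⊆X
      ... | inj₁ z = absurdᵇ (W⊆ i (trans (⊕≗∅⇒≗ W Y z i) yi)) (cong₂ _xor_ xi yi)
      ... | inj₂ z = λ j → lem (W j) (Y j) (z j)
        where
        lem : ∀ a b {c} → a xor b ≡ c → a ≡ c xor b
        lem true  true  refl = refl
        lem true  false refl = refl
        lem false true  refl = refl
        lem false false refl = refl

-- Ears of a contracted positive circuit

-- What the sign argument retains of the graph: `Z` is the cycle space of G, `Z/C` that of G / C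
-- written as sets off C, and `unique` is the battery condition on e. By `project` and `lift`,
-- restriction off C maps `Z` onto `Z/C`; its kernel consists of ∅ and C because C is a circuit.
record BatteryMatroid (m : ℕ) : Set₁ where
  open Subspace
  field
    Z Z/C     : Subspace m
    s         : 𝔽 m → Sign
    s-⊕       : ∀ X Y → s (X ⊕ Y) ≡ s X · s Y
    s-cong    : ∀ {X Y} → X ≗ Y → s X ≡ s Y
    C         : 𝔽 m
    e         : Fin m
    C-circuit : Circuit Z C
    e∈C       : C e ≡ true
    sC        : s C ≡ ⊹
    unique    : ∀ {O} → Circuit Z O → O e ≡ true → s O ≡ ⊹ → O ≗ C
    off-C     : ∀ {X} → Mem Z/C X → ∀ i → C i ≡ true → X i ≡ false
    project   : ∀ {O} → Mem Z O → Mem Z/C (O ∖ᶠ C)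
    lift      : ∀ {X} → Mem Z/C X → ∃[ T ] Mem Z T × (∀ i → C i ≡ false → T i ≡ X i)

module Battery {m : ℕ} (𝓜 : BatteryMatroid m) where
  open BatteryMatroid 𝓜
  open Subspace

  Ear : 𝔽 m → Set
  Ear X = Circuit Z/C X × ¬ Mem Z X

  PositiveCircuit : 𝔽 m → Set
  PositiveCircuit X = Circuit Z X × s X ≡ ⊹

  ∈⇒∉C : ∀ {X i} → Mem Z/C X → X i ≡ true → C i ≡ false
  ∈⇒∉C {i = i} mX xi with C i in c
  ... | false = refl
  ... | true  = absurdᵇ xi (off-C mX i c)

  -- T ⊕ O is a cycle inside the circuit C that misses e.
  cycle-unique : ∀ {T O} → Mem Z T → Mem Z O → (∀ i → C i ≡ false → T i ≡ O i) → T e ≡ O e → T ≗ O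
  cycle-unique {T} {O} mT mO agree te with proj₂ (proj₂ C-circuit) (T ⊕ O) (⊕-mem Z mT mO) T⊕O⊆C
    where
    T⊕O⊆C : T ⊕ O ⊆ᶠ C
    T⊕O⊆C i p with C i in c
    ... | true  = refl
    ... | false with T i | O i | agree i c
    ...   | true  | _ | refl = p
    ...   | false | _ | refl = p
  ... | inj₁ z = ⊕≗∅⇒≗ T O z
  ... | inj₂ z with T e | O e | te | z e
  ...   | true  | _ | refl | q = absurdᵇ e∈C (sym q)
  ...   | false | _ | refl | q = absurdᵇ e∈C (sym q)

  -- The two cycles of G over X differ by C, so requiring e selects one of them. It is the one to
  -- which `unique` can be applied.
  record Lift (X : 𝔽 m) : Set where
    field
      T     : 𝔽 m
      T∈Z   : Mem Z T
      agree : ∀ i → C i ≡ false → T i ≡ X i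
      e∈T   : T e ≡ true

  open Lift

  liftOf : ∀ {X} → Mem Z/C X → Lift X
  liftOf mX with lift mX
  ... | T , mT , agree with T e in te
  ...   | true  = record { T = T ; T∈Z = mT ; agree = agree ; e∈T = te }
  ...   | false = record
    { T     = T ⊕ C
    ; T∈Z   = ⊕-mem Z mT (proj₁ C-circuit)
    ; agree = λ i c → trans (cong (T i xor_) c) (trans (Bool.xor-identityʳ (T i)) (agree i c))
    ; e∈T   = cong₂ _xor_ te e∈C
    }

  -- Removing C from the lift leaves exactly X. Used contrapositively: the lift of an ear omits some
  -- edge of C.
  C⊆lift⇒∈Z : ∀ {X} → Mem Z/C X → (L : Lift X) → (∀ i → C i ≡ true → T L i ≡ true) → Mem Z X
  C⊆lift⇒∈Z {X} mX L C⊆T = resp Z eq (⊕-mem Z (T∈Z L) (proj₁ C-circuit))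
    where
    eq : T L ⊕ C ≗ X
    eq i with C i in c
    ... | true  = trans (cong₂ _xor_ (C⊆T i c) refl) (sym (off-C mX i c))
    ... | false = trans (Bool.xor-identityʳ _) (agree L i c)

  restrict-⊆ : ∀ {O N X : 𝔽 m} → O ⊆ᶠ N → (∀ i → C i ≡ false → N i ≡ X i) → O ∖ᶠ C ⊆ᶠ X
  restrict-⊆ {O} O⊆N agr i p with C i in c | O i in o
  ... | false | true = trans (sym (agr i c)) (O⊆N i o)

  ∖C-off : ∀ {O X : 𝔽 m} → O ∖ᶠ C ≗ X → ∀ i → C i ≡ false → O i ≡ X i
  ∖C-off {O} eq i c = trans (sym (trans (cong (λ b → O i ∧ not b) c) (Bool.∧-identityʳ (O i)))) (eq i)

  -- A circuit O through e inside the lift restricts off C to ∅ or to X. In the second case O is the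
  -- whole lift. In the first O is C, so the lift contains C and X is a cycle of G, which no ear is.
  -- The sign is negative because the lift contains an edge of X and so differs from C.
  ear-lift : ∀ {X} → Ear X → (L : Lift X) → Circuit Z (T L) × s (T L) ≡ ⊖
  ear-lift {X} (cX@(mX , (x , xx) , min) , X∉Z) L with circuitIn Z (T∈Z L) (e∈T L)
  ... | O , cO , O⊆T , oe = cT , neg
    where
    O≗T : O ≗ T L
    O≗T with min (O ∖ᶠ C) (project (proj₁ cO)) (restrict-⊆ O⊆T (agree L))
    ... | inj₂ z = cycle-unique (proj₁ cO) (T∈Z L)
                     (λ i c → trans (∖C-off z i c) (sym (agree L i c))) (trans oe (sym (e∈T L)))
    ... | inj₁ z = ⊥-elim (X∉Z (C⊆lift⇒∈Z mX L λ i c → O⊆T i (trans (O≗C i) c)))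
      where
      O≗C : O ≗ C
      O≗C = cycle-unique (proj₁ cO) (proj₁ C-circuit)
              (λ i c → trans (∖C-off z i c) (sym c)) (trans oe (sym e∈C))
    cT : Circuit Z (T L)
    cT = Circuit-resp Z O≗T cO
    neg : s (T L) ≡ ⊖
    neg with s (T L) in eq
    ... | ⊖ = refl
    ... | ⊹ = absurdᵇ xx (trans (sym (agree L x x∉C)) (trans (unique cT (e∈T L) eq x) x∉C))
      where x∉C = ∈⇒∉C mX xx

  -- A cycle of G inside X is disjoint from C, so projecting leaves it unchanged.
  circuit/C⇒circuit : ∀ {X} → Circuit Z/C X → Mem Z X → Circuit Z X
  circuit/C⇒circuit {X} (mX , inh , min) X∈Z = X∈Z , inh , λ W mW W⊆X →
    min W (resp Z/C (eq W W⊆X) (project mW)) W⊆X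
    where
    eq : ∀ W → W ⊆ᶠ X → W ∖ᶠ C ≗ W
    eq W W⊆X i with W i in w
    ... | false = refl
    ... | true  = cong not (∈⇒∉C mX (W⊆X i w))

  -- Three ears cannot sum to zero, since their three lifts are negative and sum to the positive C.
  ear-sum : ∀ {X Y} → Ear X → Ear Y → Circuit Z/C (X ⊕ Y) → PositiveCircuit (X ⊕ Y)
  ear-sum {X} {Y} eX eY cW with Mem? Z (X ⊕ Y)
  ... | yes W∈Z = circuit/C⇒circuit cW W∈Z , trans (s-cong eq) (trans (s-⊕ _ _) (cong₂ _·_ (proj₂ (ear-lift eX LX)) (proj₂ (ear-lift eY LY))))
    where
    LX = liftOf (proj₁ (proj₁ eX))
    LY = liftOf (proj₁ (proj₁ eY))
    eq : X ⊕ Y ≗ T LX ⊕ T LY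
    eq = cycle-unique W∈Z (⊕-mem Z (T∈Z LX) (T∈Z LY))
           (λ i c → sym (cong₂ _xor_ (agree LX i c) (agree LY i c)))
           (trans (off-C (proj₁ cW) e e∈C) (sym (cong₂ _xor_ (e∈T LX) (e∈T LY))))
  ... | no W∉Z with trans (sym (proj₂ (ear-lift (cW , W∉Z) LW)))
                   (trans (s-cong eq) (trans (s-⊕ _ _) (cong₂ _·_ (trans (s-⊕ _ _)
                     (cong₂ _·_ (proj₂ (ear-lift eX LX)) (proj₂ (ear-lift eY LY)))) sC)))
    where
    LX = liftOf (proj₁ (proj₁ eX))
    LY = liftOf (proj₁ (proj₁ eY))
    LW = liftOf (proj₁ cW)
    eq : T LW ≗ T LX ⊕ T LY ⊕ C
    eq = cycle-unique (T∈Z LW) (⊕-mem Z (⊕-mem Z (T∈Z LX) (T∈Z LY)) (proj₁ C-circuit))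
           (λ i c → trans (agree LW i c) (trans (sym (Bool.xor-identityʳ _))
                      (cong₂ _xor_ (sym (cong₂ _xor_ (agree LX i c) (agree LY i c))) (sym c))))
           (trans (e∈T LW) (sym (cong₂ _xor_ (cong₂ _xor_ (e∈T LX) (e∈T LY)) e∈C)))
  ... | ()

  -- The matroid form of lying in different bridges: bridges are separators of G / C, so a cycle
  -- inside X ∪ Y consists of all or nothing of each.
  record Separated (X Y : 𝔽 m) : Set where
    field
      disjoint : ∀ i → X i ≡ true → Y i ≡ false
      parts    : ∀ W → Mem Z/C W → (∀ i → W i ≡ true → X i ≡ true ⊎ Y i ≡ true) →
                 W ≗ ∅ ⊎ W ≗ X ⊎ W ≗ Y ⊎ W ≗ X ⊕ Y

  Separated-sym : ∀ {X Y} → Separated X Y → Separated Y X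
  Separated-sym {X} {Y} S = record { disjoint = dis ; parts = λ W mW W⊆ → exchange (parts W mW λ i w → swap (W⊆ i w)) }
    where
    open Separated S
    dis : ∀ i → Y i ≡ true → X i ≡ false
    dis i y with X i in x
    ... | false = refl
    ... | true  = absurdᵇ y (disjoint i x)
    exchange : ∀ {W} → W ≗ ∅ ⊎ W ≗ X ⊎ W ≗ Y ⊎ W ≗ X ⊕ Y → W ≗ ∅ ⊎ W ≗ Y ⊎ W ≗ X ⊎ W ≗ Y ⊕ X
    exchange (inj₁ z) = inj₁ z
    exchange (inj₂ (inj₁ z)) = inj₂ (inj₂ (inj₁ z))
    exchange (inj₂ (inj₂ (inj₁ z))) = inj₂ (inj₁ z)
    exchange (inj₂ (inj₂ (inj₂ z))) = inj₂ (inj₂ (inj₂ λ i → trans (z i) (Bool.xor-comm (X i) (Y i))))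

  -- The complementary cycle LX ⊕ LY ⊕ C is positive and contains e, so it is not a circuit; each way it
  -- can split is incompatible with a splitting of LX ⊕ LY.
  joined : ∀ {X Y} → Ear X → Ear Y → Separated X Y → (LX : Lift X) (LY : Lift Y) → PositiveCircuit (T LX ⊕ T LY)
  joined {X} {Y} eX@((mX , (x , xx) , _) , X∉Z) eY@((mY , _ , _) , Y∉Z) S LX LY =
    cN , trans (s-⊕ _ _) (cong₂ _·_ (proj₂ (ear-lift eX LX)) (proj₂ (ear-lift eY LY)))
    where
    open Separated S
    A B N : 𝔽 m
    A = T LX
    B = T LY
    N = A ⊕ B
    N∈Z : Mem Z N
    N∈Z = ⊕-mem Z (T∈Z LX) (T∈Z LY)
    N-off : ∀ i → C i ≡ false → N i ≡ (X ⊕ Y) i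
    N-off i c = cong₂ _xor_ (agree LX i c) (agree LY i c)
    sN : s N ≡ ⊹
    sN = trans (s-⊕ _ _) (cong₂ _·_ (proj₂ (ear-lift eX LX)) (proj₂ (ear-lift eY LY)))
    x∉C = ∈⇒∉C mX xx
    x∉Y = disjoint x xx
    Nx : N x ≡ true
    Nx = trans (N-off x x∉C) (cong₂ _xor_ xx x∉Y)
    Ne : N e ≡ false
    Ne = cong₂ _xor_ (e∈T LX) (e∈T LY)
    xor-or : ∀ {a b} → a xor b ≡ true → a ≡ true ⊎ b ≡ true
    xor-or {true}  _ = inj₁ refl
    xor-or {false} p = inj₂ p
    M : 𝔽 m
    M = N ⊕ C
    M∈Z : Mem Z M
    M∈Z = ⊕-mem Z N∈Z (proj₁ C-circuit)
    M-off : ∀ i → C i ≡ false → M i ≡ (X ⊕ Y) i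
    M-off i c = trans (cong₂ _xor_ (N-off i c) c) (Bool.xor-identityʳ _)
    Me : M e ≡ true
    Me = cong₂ _xor_ Ne e∈C
    sM : s M ≡ ⊹
    sM = trans (s-⊕ _ _) (cong₂ _·_ sN sC)

    -- The hypothesis says that C lies in A ∪ B. In the first three cases the circuit found in M
    -- then forces A or B to contain all of C, which makes an ear a cycle of G. In the last case M
    -- is a positive circuit through e, yet it contains x, which is off C.
    impossible : ¬ (∀ i → C i ≡ true → A i ≡ false → B i ≡ true)
    impossible cover with circuitIn Z M∈Z Me
    ... | O , cO , O⊆M , oe with parts (O ∖ᶠ C) (project (proj₁ cO)) (λ i o → xor-or (restrict-⊆ O⊆M M-off i o))
    ... | inj₁ z = X∉Z (C⊆lift⇒∈Z mX LX C⊆A)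
      where
      O≗C = cycle-unique (proj₁ cO) (proj₁ C-circuit) (λ i c → trans (∖C-off z i c) (sym c)) (trans oe (sym e∈C))
      C⊆A : ∀ i → C i ≡ true → A i ≡ true
      C⊆A i c with A i in a | O⊆M i (trans (O≗C i) c)
      ... | true  | _ = refl
      ... | false | q = absurdᵇ q (cong₂ _xor_ (cover i c a) c)
    ... | inj₂ (inj₁ z) = Y∉Z (C⊆lift⇒∈Z mY LY C⊆B)
      where
      O≗A = cycle-unique (proj₁ cO) (T∈Z LX) (λ i c → trans (∖C-off z i c) (sym (agree LX i c))) (trans oe (sym (e∈T LX)))
      C⊆B : ∀ i → C i ≡ true → B i ≡ true
      C⊆B i c with B i in b | A i in a
      ... | true  | _     = refl
      ... | false | false = absurdᵇ (cover i c a) b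
      ... | false | true  = absurdᵇ (O⊆M i (trans (O≗A i) a)) (cong₂ _xor_ (cong₂ _xor_ a b) c)
    ... | inj₂ (inj₂ (inj₁ z)) = X∉Z (C⊆lift⇒∈Z mX LX C⊆A)
      where
      O≗B = cycle-unique (proj₁ cO) (T∈Z LY) (λ i c → trans (∖C-off z i c) (sym (agree LY i c))) (trans oe (sym (e∈T LY)))
      C⊆A : ∀ i → C i ≡ true → A i ≡ true
      C⊆A i c with A i in a
      ... | true  = refl
      ... | false = absurdᵇ (O⊆M i (trans (O≗B i) (cover i c a))) (cong₂ _xor_ (cong₂ _xor_ a (cover i c a)) c)
    ... | inj₂ (inj₂ (inj₂ z)) = absurdᵇ (trans (sym (M≗C x)) (cong₂ _xor_ Nx x∉C)) x∉C
      where
      O≗M = cycle-unique (proj₁ cO) M∈Z (λ i c → trans (∖C-off z i c) (sym (M-off i c))) (trans oe (sym Me))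
      M≗C : M ≗ C
      M≗C = unique (Circuit-resp Z O≗M cO) Me sM

    cN : Circuit Z N
    cN with circuitIn Z N∈Z Nx
    ... | O , cO , O⊆N , ox with parts (O ∖ᶠ C) (project (proj₁ cO)) (λ i o → xor-or (restrict-⊆ O⊆N N-off i o))
    ... | inj₁ z = absurdᵇ ox (∖C-off z x x∉C)
    ... | inj₂ (inj₂ (inj₁ z)) = absurdᵇ ox (trans (∖C-off z x x∉C) x∉Y)
    ... | inj₂ (inj₂ (inj₂ z)) = Circuit-resp Z
            (cycle-unique (proj₁ cO) N∈Z (λ i c → trans (∖C-off z i c) (sym (N-off i c)))
              (trans (⊆-∨-false O⊆N e Ne) (sym Ne))) cO
    -- O lies over X and misses e, so it is A ⊕ C. Its edges on C are those outside A; they lie in N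
    -- and therefore in B.
    ... | inj₂ (inj₁ z) = ⊥-elim (impossible cover)
      where
      O≗A⊕C : O ≗ A ⊕ C
      O≗A⊕C = cycle-unique (proj₁ cO) (⊕-mem Z (T∈Z LX) (proj₁ C-circuit))
                (λ i c → trans (∖C-off z i c) (sym (trans (cong₂ _xor_ (agree LX i c) c) (Bool.xor-identityʳ _))))
                (trans (⊆-∨-false O⊆N e Ne) (sym (cong₂ _xor_ (e∈T LX) e∈C)))
      cover : ∀ i → C i ≡ true → A i ≡ false → B i ≡ true
      cover i c a = trans (sym (cong (_xor B i) a)) (O⊆N i (trans (O≗A⊕C i) (cong₂ _xor_ a c)))

  -- The two cycles of G over X differ by the positive circle C, so both are negative.
  positive-over-ear : ∀ {X O} → Ear X → Mem Z O → s O ≡ ⊹ → ¬ (O ∖ᶠ C ≗ X)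
  positive-over-ear {X} {O} eX mO sO z = contra (trans (sym sO) sO⊖)
    where
    L = liftOf (proj₁ (proj₁ eX))
    contra : ⊹ ≢ ⊖
    contra ()
    sO⊖ : s O ≡ ⊖
    sO⊖ with O e in oe
    ... | true  = trans (s-cong (cycle-unique mO (T∈Z L)
                    (λ i c → trans (∖C-off z i c) (sym (agree L i c))) (trans oe (sym (e∈T L)))))
                    (proj₂ (ear-lift eX L))
    ... | false = trans (s-cong (cycle-unique mO (⊕-mem Z (T∈Z L) (proj₁ C-circuit))
                    (λ i c → trans (∖C-off z i c) (sym (trans (cong₂ _xor_ (agree L i c) c) (Bool.xor-identityʳ _))))
                    (trans oe (sym (cong₂ _xor_ (e∈T L) e∈C)))))
                    (trans (s-⊕ _ _) (cong₂ _·_ (proj₂ (ear-lift eX L)) sC))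

  joined-unique : ∀ {X Y} → Ear X → Ear Y → (LX : Lift X) (LY : Lift Y) →
    (∀ W → Mem Z/C W → W ≗ ∅ ⊎ W ≗ X ⊎ W ≗ Y ⊎ W ≗ X ⊕ Y) →
    ∀ {O f} → PositiveCircuit O → O f ≡ true → C f ≡ false → O ≗ T LX ⊕ T LY
  joined-unique {X} {Y} eX eY LX LY parts {O} {f} (cO , sO) of f∉C with parts (O ∖ᶠ C) (project (proj₁ cO))
  ... | inj₁ z = absurdᵇ of (∖C-off z f f∉C)
  ... | inj₂ (inj₁ z) = ⊥-elim (positive-over-ear eX (proj₁ cO) sO z)
  ... | inj₂ (inj₂ (inj₁ z)) = ⊥-elim (positive-over-ear eY (proj₁ cO) sO z)
  ... | inj₂ (inj₂ (inj₂ z)) with O e in oe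
  ...   | true  = absurdᵇ of (trans (unique cO oe sO f) f∉C)
  ...   | false = cycle-unique (proj₁ cO) (⊕-mem Z (T∈Z LX) (T∈Z LY))
                    (λ i c → trans (∖C-off z i c) (sym (cong₂ _xor_ (agree LX i c) (agree LY i c))))
                    (trans oe (sym (cong₂ _xor_ (e∈T LX) (e∈T LY))))

  joined-∋ : ∀ {X Y f} → Mem Z/C X → Mem Z/C Y → Separated X Y → (LX : Lift X) (LY : Lift Y) →
    X f ≡ true ⊎ Y f ≡ true → (T LX ⊕ T LY) f ≡ true
  joined-∋ {f = f} mX mY S LX LY (inj₁ xf) =
    trans (cong₂ _xor_ (agree LX f c) (agree LY f c)) (cong₂ _xor_ xf (Separated.disjoint S f xf))
    where c = ∈⇒∉C mX xf
  joined-∋ {f = f} mX mY S LX LY (inj₂ yf) =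
    trans (cong₂ _xor_ (agree LX f c) (agree LY f c))
      (cong₂ _xor_ (Separated.disjoint (Separated-sym S) f yf) yf)
    where c = ∈⇒∉C mY yf

  -- Only the uniqueness half of being a battery; the positive circuits that violate it are built
  -- from ears.
  UniquelyPositive : Fin m → Set
  UniquelyPositive f = ∀ {O O′} → PositiveCircuit O → PositiveCircuit O′ → O f ≡ true → O′ f ≡ true → O ≗ O′

  -- If f lies in Y or in both X and X′, then joining Y with X and with X′ gives two positive
  -- circuits through f. If f lies in X alone, then X ⊕ X′ is a positive circuit through f that
  -- avoids Y, while the join of X and Y contains Y.
  two-ears : ∀ {X X′ Y f} → Ear X → Ear X′ → Circuit Z/C (X ⊕ X′) → Ear Y → Separated X Y → Separated X′ Y →
    X f ≡ true ⊎ Y f ≡ true → ¬ UniquelyPositive f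
  two-ears {X} {X′} {Y} {f} eX eX′ cW eY S S′ f∈ uniq = cases f∈
    where
    mX  = proj₁ (proj₁ eX)
    mX′ = proj₁ (proj₁ eX′)
    mY  = proj₁ (proj₁ eY)
    L   = liftOf mX
    L′  = liftOf mX′
    LY  = liftOf mY
    N∋f : (T L ⊕ T LY) f ≡ true
    N∋f = joined-∋ mX mY S L LY f∈
    through-both : X′ f ≡ true ⊎ Y f ≡ true → ⊥
    through-both f∈′ = absurdᵇ wi (trans (cong₂ _xor_ (X≗X′ i) refl) (Bool.xor-same (X′ i)))
      where
      same : T L ⊕ T LY ≗ T L′ ⊕ T LY
      same = uniq (joined eX eY S L LY) (joined eX′ eY S′ L′ LY) N∋f (joined-∋ mX′ mY S′ L′ LY f∈′)
      i = proj₁ (proj₁ (proj₂ cW))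
      wi = proj₂ (proj₁ (proj₂ cW))
      cancel : ∀ a b c → a xor c ≡ b xor c → a ≡ b
      cancel true  true  _ _ = refl
      cancel false false _ _ = refl
      cancel true  false true ()
      cancel true  false false ()
      cancel false true  true ()
      cancel false true  false ()
      X≗X′ : ∀ i → X i ≡ X′ i
      X≗X′ i with C i in c
      ... | true  = trans (off-C mX i c) (sym (off-C mX′ i c))
      ... | false = trans (sym (agree L i c)) (trans (cancel (T L i) (T L′ i) (T LY i) (same i)) (agree L′ i c))
    cases : X f ≡ true ⊎ Y f ≡ true → ⊥
    cases (inj₂ yf) = through-both (inj₂ yf)
    cases (inj₁ xf) with X′ f in x′f
    ... | true  = through-both (inj₁ x′f)
    ... | false = absurdᵇ (trans (W≗N y) (joined-∋ mX mY S L LY (inj₂ yy))) (cong₂ _xor_ (dis S) (dis S′))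
      where
      y = proj₁ (proj₁ (proj₂ (proj₁ eY)))
      yy = proj₂ (proj₁ (proj₂ (proj₁ eY)))
      W≗N : X ⊕ X′ ≗ T L ⊕ T LY
      W≗N = uniq (ear-sum eX eX′ cW) (joined eX eY S L LY) (cong₂ _xor_ xf x′f) N∋f
      dis : ∀ {X} → Separated X Y → X y ≡ false
      dis S = Separated.disjoint (Separated-sym S) y yy

  -- X is the sum of Y and X ⊕ Y, so these cannot both be cycles of G.
  theta-ear : ∀ {X Y} → ¬ Mem Z X → Circuit Z/C Y → Circuit Z/C (X ⊕ Y) → Ear Y ⊎ Ear (X ⊕ Y)
  theta-ear {X} {Y} X∉Z cY cW with Mem? Z Y
  ... | no Y∉Z  = inj₁ (cY , Y∉Z)
  ... | yes Y∈Z = inj₂ (cW , λ W∈Z → X∉Z (resp Z (λ i → cancel (X i) (Y i)) (⊕-mem Z W∈Z Y∈Z)))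
    where
    cancel : ∀ a b → (a xor b) xor b ≡ a
    cancel true  true  = refl
    cancel true  false = refl
    cancel false true  = refl
    cancel false false = refl

  -- Whichever of X′ and X ⊕ X′ is an ear, its sum with X is the other one, a circuit, as `two-ears`
  -- demands.
  no-theta : ∀ {X X′ Y f} → Ear X → Circuit Z/C X′ → Circuit Z/C (X ⊕ X′) → Ear Y →
    Separated X Y → Separated X′ Y → Separated (X ⊕ X′) Y → X f ≡ true ⊎ Y f ≡ true → ¬ UniquelyPositive f
  no-theta {X} {X′} eX cX′ cW eY S S′ S″ f∈ with theta-ear (proj₂ eX) cX′ cW
  ... | inj₁ eX′ = two-ears eX eX′ cW eY S S′ f∈
  ... | inj₂ eW  = two-ears eX eW (Circuit-resp Z/C (λ i → cancel (X i) (X′ i)) cX′) eY S S″ f∈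
    where
    cancel : ∀ a b → b ≡ a xor (a xor b)
    cancel true  true  = refl
    cancel true  false = refl
    cancel false true  = refl
    cancel false false = refl

-- Boundaries, walks and reachability

module Σᵇ = SRSum (CommutativeRing.semiring Bool.xor-∧-commutativeRing)
module Σⁿ = CMSum ℕ.+-0-commutativeMonoid
module Σˢ = CMSum Sign.*-commutativeMonoid

δ : ∀ {n} → Fin n → 𝔽 n
δ i j = does (i ≟ j)

δ-refl : ∀ {n} (i : Fin n) → δ i i ≡ true
δ-refl i = dec-true (i ≟ i) refl

δ-≢ : ∀ {n} {i j : Fin n} → i ≢ j → δ i j ≡ false
δ-≢ {i = i} {j} = dec-false (i ≟ j)

δ⇒≡ : ∀ {n} (i j : Fin n) → δ i j ≡ true → i ≡ j
δ⇒≡ i j p with i ≟ j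
... | yes q = q

Σᵇ-zero : ∀ {n} {f : 𝔽 n} → f ≗ ∅ → Σᵇ.sum f ≡ false
Σᵇ-zero {zero}  p = refl
Σᵇ-zero {suc n} p = cong₂ _xor_ (p zero) (Σᵇ-zero (p ∘ suc))

Σᵇ-support : ∀ {n} {f : 𝔽 n} i → (∀ j → j ≢ i → f j ≡ false) → Σᵇ.sum f ≡ f i
Σᵇ-support {f = f} zero p = trans (cong (f zero xor_) (Σᵇ-zero λ j → p (suc j) λ ())) (Bool.xor-identityʳ _)
Σᵇ-support (suc i) p = cong₂ _xor_ (p zero λ ()) (Σᵇ-support i λ j j≢i → p (suc j) λ { refl → j≢i refl })

Σⁿ-support : ∀ {n} {f : Fin n → ℕ} i → (∀ j → j ≢ i → f j ≡ 0) → Σⁿ.sum f ≡ f i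
Σⁿ-support {suc n} {f} zero p =
  trans (cong (f zero +_) (trans (Σⁿ.sum-cong-≗ λ j → p (suc j) λ ()) (Σⁿ.sum-replicate-zero n))) (ℕ.+-identityʳ _)
Σⁿ-support (suc i) p = cong₂ _+_ (p zero λ ()) (Σⁿ-support i λ j j≢i → p (suc j) λ { refl → j≢i refl })

Σⁿ-≡0 : ∀ {n} {f : Fin n → ℕ} → Σⁿ.sum f ≡ 0 → ∀ i → f i ≡ 0
Σⁿ-≡0 {f = f} p zero    = ℕ.m+n≡0⇒m≡0 (f zero) p
Σⁿ-≡0 {f = f} p (suc i) = Σⁿ-≡0 (ℕ.m+n≡0⇒n≡0 (f zero) p) i

bit : Bool → ℕ
bit true  = 1
bit false = 0

odd : ℕ → Bool
odd zero    = false
odd (suc n) = not (odd n)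

odd-+ : ∀ m n → odd (m + n) ≡ odd m xor odd n
odd-+ zero    n = refl
odd-+ (suc m) n = trans (cong not (odd-+ m n)) (Bool.not-distribˡ-xor (odd m) (odd n))

odd-bit : ∀ b → odd (bit b) ≡ b
odd-bit true  = refl
odd-bit false = refl

odd-Σ : ∀ {n} (f : Fin n → ℕ) → odd (Σⁿ.sum f) ≡ Σᵇ.sum (odd ∘ f)
odd-Σ {zero}  f = refl
odd-Σ {suc n} f = trans (odd-+ (f zero) _) (cong (odd (f zero) xor_) (odd-Σ (f ∘ suc)))

∣∣-Σ : ∀ {n} (S : Subset n) → ∣ S ∣ ≡ Σⁿ.sum (bit ∘ lookup S)
∣∣-Σ [] = refl
∣∣-Σ (true ∷ S)  = cong suc (∣∣-Σ S)
∣∣-Σ (false ∷ S) = ∣∣-Σ S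

∈⇒≡ : ∀ {n} {S : Subset n} {i} → i ∈ S → lookup S i ≡ true
∈⇒≡ = []=⇒lookup

≡⇒∈ : ∀ {n} {S : Subset n} {i} → lookup S i ≡ true → i ∈ S
≡⇒∈ {S = S} {i} = lookup⇒[]= i S

∉⇒≡ : ∀ {n} {S : Subset n} {i} → i ∉ S → lookup S i ≡ false
∉⇒≡ {S = S} {i} p with lookup S i in eq
... | true  = ⊥-elim (p (≡⇒∈ eq))
... | false = refl

≡⇒∉ : ∀ {n} {S : Subset n} {i} → lookup S i ≡ false → i ∉ S
≡⇒∉ p q = absurdᵇ (∈⇒≡ q) p

lookup-⁅⁆ : ∀ {n} (v x : Fin n) → lookup ⁅ v ⁆ x ≡ δ x v
lookup-⁅⁆ v x with x ≟ v
... | yes refl = ∈⇒≡ (x∈⁅x⁆ v)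
... | no x≢v   = ∉⇒≡ λ q → x≢v (x∈⁅y⁆⇒x≡y v q)

from-does : ∀ {A : Set} (a? : Dec A) → does a? ≡ true → A
from-does (yes a) _ = a

⟦_⟧ : ∀ {n} {P : Fin n → Set} → Decidable P → Subset n
⟦ P? ⟧ = tabulate (does ∘ P?)

∈-⟦⟧⁺ : ∀ {n} {P : Fin n → Set} (P? : Decidable P) {i} → P i → i ∈ ⟦ P? ⟧
∈-⟦⟧⁺ P? {i} p = ≡⇒∈ (trans (lookup∘tabulate _ i) (dec-true (P? i) p))

∈-⟦⟧⁻ : ∀ {n} {P : Fin n → Set} (P? : Decidable P) {i} → i ∈ ⟦ P? ⟧ → P i
∈-⟦⟧⁻ P? {i} p with P? i | trans (sym (lookup∘tabulate (does ∘ P?) i)) (∈⇒≡ p)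
... | yes q | _ = q

-- Warshall's algorithm: Via k admits walks whose inner vertices have index below k.
module _ {n : ℕ} {R : Fin n → Fin n → Set} (R? : ∀ u v → Dec (R u v)) where

  private
    Via : ℕ → Fin n → Fin n → Set
    Via zero    u v = u ≡ v ⊎ R u v
    Via (suc k) u v = Via k u v ⊎ ∃[ w ] toℕ w ≡ k × Via k u w × Via k w v

    via? : ∀ k u v → Dec (Via k u v)
    via? zero    u v = (u ≟ v) ⊎-dec R? u v
    via? (suc k) u v = via? k u v ⊎-dec any? λ w → (toℕ w ℕ.≟ k) ×-dec via? k u w ×-dec via? k w v

    sound : ∀ k {u v} → Via k u v → Star R u v
    sound zero    (inj₁ refl) = ε
    sound zero    (inj₂ r)    = r ◅ ε
    sound (suc k) (inj₁ p)    = sound k p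
    sound (suc k) (inj₂ (w , _ , p , q)) = sound k p ◅◅ sound k q

    via-trans : ∀ k {u w v} → toℕ w < k → Via k u w → Via k w v → Via k u v
    via-trans (suc k) {w = w} w<k p q with toℕ w ℕ.≟ k
    via-trans (suc k) _ (inj₁ p) (inj₁ q) | yes w≡k = inj₂ (_ , w≡k , p , q)
    via-trans (suc k) {w = w} _ (inj₂ (x , x≡k , p , _)) (inj₁ q) | yes w≡k
      with refl ← toℕ-injective {i = x} {w} (trans x≡k (sym w≡k)) = inj₂ (x , x≡k , p , q)
    via-trans (suc k) {w = w} _ (inj₁ p) (inj₂ (y , y≡k , _ , q)) | yes w≡k
      with refl ← toℕ-injective {i = y} {w} (trans y≡k (sym w≡k)) = inj₂ (y , y≡k , p , q)
    via-trans (suc k) w<k (inj₁ p) (inj₁ q) | no w≢k = inj₁ (via-trans k (ℕ.≤∧≢⇒< (ℕ.≤-pred w<k) w≢k) p q)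
    via-trans (suc k) w<k (inj₂ (x , x≡k , p , p′)) (inj₁ q) | no w≢k =
      inj₂ (x , x≡k , p , via-trans k (ℕ.≤∧≢⇒< (ℕ.≤-pred w<k) w≢k) p′ q)
    via-trans (suc k) w<k (inj₁ p) (inj₂ (y , y≡k , q , q′)) | no w≢k =
      inj₂ (y , y≡k , via-trans k (ℕ.≤∧≢⇒< (ℕ.≤-pred w<k) w≢k) p q , q′)
    -- Both walks pass the vertex of index k; everything between its first and last visit is
    -- dropped.
    via-trans (suc k) _ (inj₂ (x , x≡k , p , _)) (inj₂ (y , y≡k , _ , q)) | _
      with refl ← toℕ-injective {i = x} {y} (trans x≡k (sym y≡k)) = inj₂ (x , x≡k , p , q)

    weaken : ∀ k {u v} → Via 0 u v → Via k u v
    weaken zero    p = p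
    weaken (suc k) p = inj₁ (weaken k p)

    complete : ∀ {u v} → Star R u v → Via n u v
    complete ε = weaken n (inj₁ refl)
    complete (_◅_ {j = w} r rs) = via-trans n (toℕ<n w) (weaken n (inj₂ r)) (complete rs)

  abstract
    star? : ∀ u v → Dec (Star R u v)
    star? u v = map′ (sound n) complete (via? n u v)

module Incidence (G : Graph) where
  open Graph G

  joins? : ∀ f u v → Dec (Joins f u v)
  joins? f u v = ((end₁ f ≟ u) ×-dec (end₂ f ≟ v)) ⊎-dec ((end₁ f ≟ v) ×-dec (end₂ f ≟ u))

  incident? : ∀ f v → Dec (Incident f v)
  incident? f v = (end₁ f ≟ v) ⊎-dec (end₂ f ≟ v)

  reachable? : ∀ (H : Subgraph G) u v → Dec (Reachable H u v)
  reachable? H = star? λ u v → any? λ f → (f ∈? E H) ×-dec joins? f u v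

  joins-sym : ∀ {f u v} → Joins f u v → Joins f v u
  joins-sym (inj₁ (p , q)) = inj₂ (p , q)
  joins-sym (inj₂ (p , q)) = inj₁ (p , q)

  joins⇒incident : ∀ {f u v} → Joins f u v → Incident f u
  joins⇒incident (inj₁ (p , _)) = inj₁ p
  joins⇒incident (inj₂ (_ , q)) = inj₂ q

  incident⇒joins : ∀ {f u} → Incident f u → ∃[ v ] Joins f u v
  incident⇒joins {f} (inj₁ p) = end₂ f , inj₁ (p , refl)
  incident⇒joins {f} (inj₂ p) = end₁ f , inj₂ (refl , p)

  joins-unique : ∀ {f u v w} → Joins f u v → Incident f w → w ≡ u ⊎ w ≡ v
  joins-unique (inj₁ (refl , refl)) (inj₁ refl) = inj₁ refl
  joins-unique (inj₁ (refl , refl)) (inj₂ refl) = inj₂ refl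
  joins-unique (inj₂ (refl , refl)) (inj₁ refl) = inj₂ refl
  joins-unique (inj₂ (refl , refl)) (inj₂ refl) = inj₁ refl

  reachable-sym : ∀ {H : Subgraph G} {u v} → Reachable H u v → Reachable H v u
  reachable-sym ε = ε
  reachable-sym {H} ((f , f∈ , j) ◅ r) = reachable-sym {H} r ◅◅ ((f , f∈ , joins-sym j) ◅ ε)

  -- The incidence matrix over the two-element field, in which the two ends of a loop cancel.
  inc : Edge → Vertex → Bool
  inc f v = δ (end₁ f) v xor δ (end₂ f) v

  inc-joins : ∀ {f u v} → Joins f u v → ∀ x → inc f x ≡ δ u x xor δ v x
  inc-joins (inj₁ (refl , refl)) x = refl
  inc-joins {f} (inj₂ (refl , refl)) x = Bool.xor-comm (δ (end₁ f) x) (δ (end₂ f) x)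

  inc-¬ : ∀ {f v} → ¬ Incident f v → inc f v ≡ false
  inc-¬ ¬i = cong₂ _xor_ (δ-≢ (¬i ∘ inj₁)) (δ-≢ (¬i ∘ inj₂))

  inc-true : ∀ {f u v} → Joins f u v → u ≢ v → inc f u ≡ true
  inc-true {u = u} j u≢v = trans (inc-joins j u) (cong₂ _xor_ (δ-refl u) (δ-≢ (u≢v ∘ sym)))

  inc⇒joins : ∀ {f u} → inc f u ≡ true → ∃[ v ] Joins f u v × u ≢ v
  inc⇒joins {f} {u} p with end₁ f ≟ u in q | end₂ f ≟ u in r
  ... | yes refl | no ne    = end₂ f , inj₁ (refl , refl) , (ne ∘ sym)
  ... | no ne    | yes refl = end₁ f , inj₂ (refl , refl) , (ne ∘ sym)

  inc-false : ∀ {f v} → Incident f v → inc f v ≡ false → end₁ f ≡ v × end₂ f ≡ v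
  inc-false {f} {v} i p with end₁ f ≟ v | end₂ f ≟ v
  ... | yes q | yes r = q , r
  inc-false (inj₁ q) p | no ne | no _  = ⊥-elim (ne q)
  inc-false (inj₂ q) p | no _  | no ne = ⊥-elim (ne q)

  ∂ : 𝔽 size → 𝔽 order
  ∂ X v = Σᵇ.sum λ f → X f ∧ inc f v

  ∂-local : ∀ {X Y v} → (∀ f → Incident f v → X f ≡ Y f) → ∂ X v ≡ ∂ Y v
  ∂-local {X} {Y} {v} p = Σᵇ.sum-cong-≗ eq
    where
    eq : ∀ f → X f ∧ inc f v ≡ Y f ∧ inc f v
    eq f with incident? f v
    ... | yes i = cong (_∧ inc f v) (p f i)
    ... | no ¬i = trans (cong (X f ∧_) (inc-¬ ¬i))
                    (trans (Bool.∧-zeroʳ (X f)) (sym (trans (cong (Y f ∧_) (inc-¬ ¬i)) (Bool.∧-zeroʳ (Y f)))))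

  ∂-cong : ∀ {X Y} → X ≗ Y → ∂ X ≗ ∂ Y
  ∂-cong p v = ∂-local λ f _ → p f

  ∂-∅ : ∂ ∅ ≗ ∅
  ∂-∅ v = Σᵇ-zero {size} λ _ → refl

  ∂-⊕ : ∀ X Y → ∂ (X ⊕ Y) ≗ ∂ X ⊕ ∂ Y
  ∂-⊕ X Y v = trans (Σᵇ.sum-cong-≗ λ f → Bool.∧-distribʳ-xor (inc f v) (X f) (Y f))
                (Σᵇ.∑-distrib-+ (λ f → X f ∧ inc f v) (λ f → Y f ∧ inc f v))

  ∂-δ : ∀ g → ∂ (δ g) ≗ inc g
  ∂-δ g v = trans (Σᵇ-support g λ f f≢g → cong (_∧ inc f v) (δ-≢ (f≢g ∘ sym))) (cong (_∧ inc g v) (δ-refl g))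

  -- After exchanging the sums, every edge contributes its two ends, which cancel.
  handshake : ∀ X → Σᵇ.sum (∂ X) ≡ false
  handshake X = trans (Σᵇ.∑-comm λ v f → X f ∧ inc f v) (Σᵇ-zero λ f →
    trans (sym (Σᵇ.*-distribˡ-sum (X f) (inc f)))
      (trans (cong (X f ∧_) (trans (Σᵇ.∑-distrib-+ (δ (end₁ f)) (δ (end₂ f))) (cong₂ _xor_ (Σδ (end₁ f)) (Σδ (end₂ f)))))
        (Bool.∧-zeroʳ (X f))))
    where
    Σδ : ∀ {n} (i : Fin n) → Σᵇ.sum (δ i) ≡ true
    Σδ i = trans (Σᵇ-support i λ j j≢i → δ-≢ (j≢i ∘ sym)) (δ-refl i)

  ∂-single : ∀ {X} v → (∀ u → u ≢ v → ∂ X u ≡ false) → ∂ X v ≡ false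
  ∂-single {X} v p = trans (sym (Σᵇ-support v p)) (handshake X)

  cycles : Subspace size
  cycles = record
    { Mem   = λ X → ∂ X ≗ ∅
    ; Mem?  = λ X → ∂ X ≗? ∅
    ; ⊕-mem = λ {X} {Y} p q v → trans (∂-⊕ X Y v) (cong₂ _xor_ (p v) (q v))
    ; resp  = λ eq p v → trans (sym (∂-cong eq v)) (p v)
    ; ∅-mem = ∂-∅
    }

  abstract
    -- The witness is the set of edges used an odd number of times, so repeated vertices and edges
    -- do no harm.
    walk : ∀ {H : Subgraph G} {u v} → Reachable H u v →
      ∃[ p ] (∀ f → p f ≡ true → f ∈ E H) × (∀ x → ∂ p x ≡ δ u x xor δ v x)
    walk {u = u} ε = ∅ , (λ f ()) , λ x → trans (∂-∅ x) (sym (Bool.xor-same (δ u x)))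
    walk {H} {u} {v} (_◅_ {j = w} (g , g∈ , j) r) with walk {H} r
    ... | p , p⊆ , ∂p = δ g ⊕ p , δgp⊆ , λ x →
            trans (∂-⊕ (δ g) p x) (trans (cong₂ _xor_ (trans (∂-δ g x) (inc-joins j x)) (∂p x)) (lem (δ u x) (δ w x) (δ v x)))
      where
      lem : ∀ a b c → (a xor b) xor (b xor c) ≡ a xor c
      lem true  true  c = refl
      lem true  false c = refl
      lem false true  true  = refl
      lem false true  false = refl
      lem false false c = refl
      δgp⊆ : ∀ f → (δ g ⊕ p) f ≡ true → f ∈ E H
      δgp⊆ f q with g ≟ f
      ... | yes refl = g∈
      ... | no _     = p⊆ f q

  ∂-extend : ∀ {p g h a b u v} → Joins g a u → Joins h b v → (∀ x → ∂ p x ≡ δ u x xor δ v x) →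
    ∀ x → ∂ (p ⊕ δ g ⊕ δ h) x ≡ δ a x xor δ b x
  ∂-extend {p} {g} {h} {a} {b} {u} {v} jg jh ∂p x = trans (∂-⊕ (p ⊕ δ g) (δ h) x)
    (trans (cong₂ _xor_ (trans (∂-⊕ p (δ g) x) (cong₂ _xor_ (∂p x) (trans (∂-δ g x) (inc-joins {g} jg x))))
                        (trans (∂-δ h x) (inc-joins {h} jh x)))
      (lem (δ u x) (δ v x) (δ a x) (δ b x)))
    where
    lem : ∀ u v a b → ((u xor v) xor (a xor u)) xor (b xor v) ≡ a xor b
    lem = solve 4 (λ u v a b → ((u :+ v) :+ (a :+ u)) :+ (b :+ v) := a :+ b) refl

  -- Otherwise g would be the only edge of X at w, and w would be odd.
  pair-at : ∀ {X w g h} → ∂ X w ≡ false → X g ≡ true → inc g w ≡ true →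
    (∀ f → X f ≡ true → Incident f w → f ≡ g ⊎ f ≡ h) → X h ≡ true
  pair-at {X} {w} {g} {h} ∂X xg ig only with X h in xh
  ... | true  = refl
  ... | false = absurdᵇ (trans (∂-local eq) (trans (∂-δ g w) ig)) ∂X
    where
    eq : ∀ f → Incident f w → X f ≡ δ g f
    eq f i with X f in xf
    ... | false = sym (δ-≢ {i = g} {f} λ { refl → absurdᵇ xg xf })
    ... | true with only f xf i
    ...   | inj₁ refl = sym (δ-refl g)
    ...   | inj₂ refl = absurdᵇ xf xh

  second-edge : ∀ {X w g} → ∂ X w ≡ false → X g ≡ true → inc g w ≡ true →
    ∃[ h ] h ≢ g × X h ≡ true × inc h w ≡ true
  second-edge {X} {w} {g} ∂X xg ig with any? (λ h → ¬? (h ≟ g) ×-dec (X h Bool.≟ true) ×-dec (inc h w Bool.≟ true))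
  ... | yes p = p
  ... | no ¬p = absurdᵇ (trans (Σᵇ-support g only) (cong₂ _∧_ xg ig)) ∂X
    where
    only : ∀ f → f ≢ g → X f ∧ inc f w ≡ false
    only f f≢g with X f in xf | inc f w in fi
    ... | false | _     = refl
    ... | true  | false = refl
    ... | true  | true  = ⊥-elim (¬p (f , f≢g , xf , fi))

  -- Evenness at v itself follows from the handshake lemma, all other vertices being even.
  cut : ∀ {X} → ∂ X ≗ ∅ → (S : 𝔽 order) → ∀ v → S v ≡ false →
    (∀ f x y → X f ≡ true → Joins f x y → S x ≡ true → S y ≡ true ⊎ y ≡ v) →
    ∂ (λ f → X f ∧ (S (end₁ f) ∨ S (end₂ f))) ≗ ∅
  cut {X} ∂X S v v∉S leaves = cycle
    where
    Y : 𝔽 size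
    Y f = X f ∧ (S (end₁ f) ∨ S (end₂ f))
    at : ∀ x → x ≢ v → ∂ Y x ≡ false
    at x x≢v with S x in sx
    ... | true  = trans (∂-local {Y = X} eq) (∂X x)
      where
      eq : ∀ f → Incident f x → Y f ≡ X f
      eq f (inj₁ refl) = trans (cong (λ b → X f ∧ (b ∨ S (end₂ f))) sx) (Bool.∧-identityʳ (X f))
      eq f (inj₂ refl) = trans (cong (λ b → X f ∧ (S (end₁ f) ∨ b)) sx)
                           (trans (cong (X f ∧_) (Bool.∨-zeroʳ _)) (Bool.∧-identityʳ (X f)))
    ... | false = trans (∂-local {Y = ∅} eq) (∂-∅ x)
      where
      far : ∀ f y → X f ≡ true → Joins f y x → S y ≡ false
      far f y xf j with S y in sy
      ... | false = refl
      ... | true with leaves f y x xf j sy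
      ...   | inj₁ q = absurdᵇ q sx
      ...   | inj₂ q = ⊥-elim (x≢v q)
      eq : ∀ f → Incident f x → Y f ≡ false
      eq f i with X f in xf
      ... | false = refl
      eq f (inj₁ refl) | true = cong₂ _∨_ sx (far f _ xf (inj₂ (refl , refl)))
      eq f (inj₂ refl) | true = cong₂ _∨_ (far f _ xf (inj₁ (refl , refl))) sx
    cycle : ∂ Y ≗ ∅
    cycle x with x ≟ v
    ... | no x≢v   = at x x≢v
    ... | yes refl = ∂-single v at

-- Circles are the circuits of the cycle space

module Circles (G : Graph) where
  open Graph G
  open Incidence G

  end-bits : Edge → Vertex → ℕ
  end-bits f v = bit (δ (end₁ f) v) + bit (δ (end₂ f) v)

  deg : 𝔽 size → Vertex → ℕ
  deg X v = Σⁿ.sum λ f → bit (X f ∧ δ (end₁ f) v) + bit (X f ∧ δ (end₂ f) v)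

  degree-deg : ∀ (H : Subgraph G) v → degree H v ≡ deg (lookup (E H)) v
  degree-deg H v = trans (cong₂ _+_ (side end₁) (side end₂))
    (sym (Σⁿ.∑-distrib-+ (λ f → bit (lookup (E H) f ∧ δ (end₁ f) v)) (λ f → bit (lookup (E H) f ∧ δ (end₂ f) v))))
    where
    side : ∀ (end : Edge → Vertex) →
      ∣ E H ∩ preimage end ⁅ v ⁆ ∣ ≡ Σⁿ.sum λ f → bit (lookup (E H) f ∧ δ (end f) v)
    side end = trans (∣∣-Σ (E H ∩ preimage end ⁅ v ⁆)) (Σⁿ.sum-cong-≗ λ f → cong bit
      (trans (lookup-zipWith _∧_ f (E H) (preimage end ⁅ v ⁆))
        (cong (lookup (E H) f ∧_) (trans (lookup∘tabulate _ f) (lookup-⁅⁆ v (end f))))))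

  odd-deg : ∀ X v → odd (deg X v) ≡ ∂ X v
  odd-deg X v = trans (odd-Σ {size} _) (Σᵇ.sum-cong-≗ eq)
    where
    eq : ∀ f → odd (bit (X f ∧ δ (end₁ f) v) + bit (X f ∧ δ (end₂ f) v)) ≡ X f ∧ inc f v
    eq f = trans (odd-+ (bit (X f ∧ δ (end₁ f) v)) _)
      (trans (cong₂ _xor_ (odd-bit (X f ∧ δ (end₁ f) v)) (odd-bit (X f ∧ δ (end₂ f) v)))
        (sym (Bool.∧-distribˡ-xor (X f) (δ (end₁ f) v) (δ (end₂ f) v))))

  deg-split : ∀ {X Y W v} → (∀ f → Incident f v → bit (X f) ≡ bit (Y f) + bit (W f)) →
    deg X v ≡ deg Y v + deg W v
  deg-split {X} {Y} {W} {v} p = trans (Σⁿ.sum-cong-≗ eq) (Σⁿ.∑-distrib-+ (term Y) (term W))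
    where
    term : 𝔽 size → Edge → ℕ
    term X f = bit (X f ∧ δ (end₁ f) v) + bit (X f ∧ δ (end₂ f) v)
    term-* : ∀ X f → term X f ≡ bit (X f) * end-bits f v
    term-* X f with X f
    ... | true  = sym (ℕ.+-identityʳ _)
    ... | false = refl
    eq : ∀ f → term X f ≡ term Y f + term W f
    eq f = trans (term-* X f) (trans (split f)
      (trans (ℕ.*-distribʳ-+ (end-bits f v) (bit (Y f)) (bit (W f))) (sym (cong₂ _+_ (term-* Y f) (term-* W f)))))
      where
      split : ∀ f → bit (X f) * end-bits f v ≡ (bit (Y f) + bit (W f)) * end-bits f v
      split f with incident? f v
      ... | yes i = cong (_* end-bits f v) (p f i)
      ... | no ¬i = trans (zero′ (bit (X f))) (sym (zero′ (bit (Y f) + bit (W f))))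
        where
        zero′ : ∀ n → n * end-bits f v ≡ 0
        zero′ n = trans (cong (n *_) (cong₂ _+_ (cong bit (δ-≢ (¬i ∘ inj₁))) (cong bit (δ-≢ (¬i ∘ inj₂)))))
                    (ℕ.*-zeroʳ n)

  deg-δ : ∀ g v → deg (δ g) v ≡ end-bits g v
  deg-δ g v = trans
    (Σⁿ-support g λ f f≢g → cong₂ _+_ (cong (λ b → bit (b ∧ δ (end₁ f) v)) (δ-≢ (f≢g ∘ sym)))
                                      (cong (λ b → bit (b ∧ δ (end₂ f) v)) (δ-≢ (f≢g ∘ sym))))
    (cong (λ b → bit (b ∧ δ (end₁ g) v) + bit (b ∧ δ (end₂ g) v)) (δ-refl g))

  deg-cong : ∀ {X Y} → X ≗ Y → ∀ v → deg X v ≡ deg Y v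
  deg-cong eq v = Σⁿ.sum-cong-≗ λ f → cong (λ b → bit (b ∧ δ (end₁ f) v) + bit (b ∧ δ (end₂ f) v)) (eq f)

  deg≡0 : ∀ {X v} → deg X v ≡ 0 → ∀ f → Incident f v → X f ≡ false
  deg≡0 {X} {v} p f i with X f in xf | Σⁿ-≡0 p f
  ... | false | _ = refl
  deg≡0 {v = v} p f (inj₁ refl) | true | q rewrite δ-refl (end₁ f) = ⊥-elim (ℕ.1+n≢0 q)
  deg≡0 {v = v} p f (inj₂ refl) | true | q rewrite δ-refl (end₂ f) =
    ⊥-elim (ℕ.1+n≢0 (ℕ.m+n≡0⇒n≡0 (bit (δ (end₁ f) (end₂ f))) q))

  deg≢0 : ∀ {X v} → deg X v ≢ 0 → ∃[ f ] X f ≡ true × Incident f v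
  deg≢0 {X} {v} p with any? (λ f → (X f Bool.≟ true) ×-dec incident? f v)
  ... | yes q = q
  ... | no ¬q = ⊥-elim (p (trans (Σⁿ.sum-cong-≗ eq) (Σⁿ.sum-replicate-zero size)))
    where
    eq : ∀ f → bit (X f ∧ δ (end₁ f) v) + bit (X f ∧ δ (end₂ f) v) ≡ 0
    eq f with X f in xf
    ... | false = refl
    ... | true  = cong₂ _+_ (cong bit (δ-≢ λ i → ¬q (f , xf , inj₁ i))) (cong bit (δ-≢ λ i → ¬q (f , xf , inj₂ i)))

  incident-∈V : ∀ (H : Subgraph G) {f v} → f ∈ E H → Incident f v → v ∈ V H
  incident-∈V H f∈ (inj₁ refl) = proj₁ (closed H f∈)
  incident-∈V H f∈ (inj₂ refl) = proj₂ (closed H f∈)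

  module _ {H : Subgraph G} (circle : IsCircle H) where

    circle-edge-at : ∀ {v} → v ∈ V H → ∃[ f ] f ∈ E H × Incident f v
    circle-edge-at {v} v∈ with deg≢0 (λ z → ℕ.1+n≢0 (trans (sym (proj₂ circle v∈)) (trans (degree-deg H v) z)))
    ... | f , ff , i = f , ≡⇒∈ ff , i

    circle-∂ : ∂ (lookup (E H)) ≗ ∅
    circle-∂ v with v ∈? V H
    ... | yes v∈ = trans (sym (odd-deg _ v)) (cong odd (trans (sym (degree-deg H v)) (proj₂ circle v∈)))
    ... | no v∉  = trans (∂-local λ f i → ∉⇒≡ (λ f∈ → v∉ (incident-∈V H f∈ i))) (∂-∅ v)

    -- At a vertex that a cycle W inside the circle touches, W has an even nonzero degree of at most
    -- 2, so it contains every edge of the circle there. Connectedness spreads this to the whole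
    -- circle.
    circle⇒circuit : Circuit cycles (lookup (E H))
    circle⇒circuit = circle-∂ , inhabited , λ W ∂W W⊆ → min W ∂W W⊆
      where
      inhabited : Inhabited (lookup (E H))
      inhabited with proj₁ (proj₁ circle)
      ... | v , v∈ with circle-edge-at v∈
      ...   | f , f∈ , _ = f , ∈⇒≡ f∈
      min : ∀ W → ∂ W ≗ ∅ → W ⊆ᶠ lookup (E H) → W ≗ ∅ ⊎ W ≗ lookup (E H)
      min W ∂W W⊆ with any? (λ f → W f Bool.≟ true)
      ... | no ¬w = inj₁ λ f → Bool.¬-not (λ wf → ¬w (f , wf))
      ... | yes (g , wg) = inj₂ all
        where
        Full : Vertex → Set
        Full v = ∀ f → f ∈ E H → Incident f v → W f ≡ true
        spread : ∀ {f v} → W f ≡ true → Incident f v → Full v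
        spread {f} {v} wf i h h∈ ih with W h in wh
        ... | true  = refl
        ... | false = absurdᵇ (trans (cong₂ _∧_ (∈⇒≡ h∈) (cong not wh)) refl)
                        (deg≡0 {lookup (E H) ∖ᶠ W} (two (deg W v) _ sum≡2 even (λ z → absurdᵇ wf (deg≡0 {W} z f i))) h ih)
          where
          v∈ : v ∈ V H
          v∈ = incident-∈V H (≡⇒∈ (W⊆ f wf)) i
          sum≡2 : deg W v + deg (lookup (E H) ∖ᶠ W) v ≡ 2
          sum≡2 = trans (sym (deg-split {lookup (E H)} {W} {lookup (E H) ∖ᶠ W} λ f _ → bits f)) (trans (sym (degree-deg H v)) (proj₂ circle v∈))
            where
            bits : ∀ f → bit (lookup (E H) f) ≡ bit (W f) + bit ((lookup (E H) ∖ᶠ W) f)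
            bits f with W f | lookup (E H) f | W⊆ f
            ... | true  | true  | _ = refl
            ... | true  | false | q = absurdᵇ (q refl) refl
            ... | false | true  | _ = refl
            ... | false | false | _ = refl
          even : odd (deg W v) ≡ false
          even = trans (odd-deg W v) (∂W v)
          two : ∀ a b → a + b ≡ 2 → odd a ≡ false → a ≢ 0 → b ≡ 0
          two 0 b _ _ nz = ⊥-elim (nz refl)
          two 1 b _ () _
          two 2 b s _ _ = ℕ.+-cancelˡ-≡ 2 b 0 s
          two (suc (suc (suc a))) b () _ _
        full-along : ∀ {u v} → Reachable H u v → Full u → Full v
        full-along ε p = p
        full-along ((f , f∈ , j) ◅ r) p = full-along r (spread (p f f∈ (joins⇒incident j)) (joins⇒incident (joins-sym {f} j)))
        all : W ≗ lookup (E H)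
        all f with lookup (E H) f in ff
        ... | true  = full-along (proj₂ (proj₁ circle) (proj₁ (closed H (≡⇒∈ (W⊆ g wg)))) (proj₁ (closed H (≡⇒∈ ff))))
                        (spread wg (inj₁ refl)) f (≡⇒∈ ff) (inj₁ refl)
        ... | false = ⊆-∨-false W⊆ f ff

  -- Every vertex of a circle has degree 2 and so lies on an edge; the edge set therefore determines
  -- the vertex set.
  circle-≐ : ∀ {H K : Subgraph G} → IsCircle H → IsCircle K → lookup (E H) ≗ lookup (E K) → H ≐ K
  circle-≐ {H} {K} cH cK eq =
    ⊆-antisym (V⊆ {H} {K} cH λ f∈ → ≡⇒∈ (trans (sym (eq _)) (∈⇒≡ f∈)))
              (V⊆ {K} {H} cK λ f∈ → ≡⇒∈ (trans (eq _) (∈⇒≡ f∈))) ,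
    ⊆-antisym (λ f∈ → ≡⇒∈ (trans (sym (eq _)) (∈⇒≡ f∈))) (λ f∈ → ≡⇒∈ (trans (eq _) (∈⇒≡ f∈)))
    where
    V⊆ : ∀ {H K : Subgraph G} → IsCircle H → (∀ {f} → f ∈ E H → f ∈ E K) → ∀ {v} → v ∈ V H → v ∈ V K
    V⊆ {H} {K} cH E⊆ v∈ with circle-edge-at {H} cH v∈
    ... | f , f∈ , i = incident-∈V K (E⊆ f∈) i

  ∖-∈E : ∀ {H : Subgraph G} {S f} → f ∈ E H → end₁ f ∉ S → end₂ f ∉ S → f ∈ E (H ∖ S)
  ∖-∈E {S = S} f∈ p q = x∈p∩q⁺ (f∈ , x∈p∩q⁺ (pre end₁ p , pre end₂ q))
    where
    pre : ∀ (end : Edge → Vertex) {f} → end f ∉ S → f ∈ preimage end (∁ S)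
    pre end {f} p = ≡⇒∈ (trans (lookup∘tabulate _ f) (∈⇒≡ (x∉p⇒x∈∁p p)))

  ∖-∈V⁻ : ∀ {H : Subgraph G} {S v} → v ∈ V (H ∖ S) → v ∈ V H × v ∉ S
  ∖-∈V⁻ {H} {S} p with x∈p∩q⁻ (V H) (∁ S) p
  ... | a , b = a , x∈∁p⇒x∉p b

  ∖-∈E⁻ : ∀ {H : Subgraph G} {S f} → f ∈ E (H ∖ S) → f ∈ E H
  ∖-∈E⁻ {H} p = proj₁ (x∈p∩q⁻ (E H) _ p)

  reachable-∈V : ∀ {H : Subgraph G} {u v} → u ∈ V H → Reachable H u v → v ∈ V H
  reachable-∈V u∈ ε = u∈
  reachable-∈V {H} u∈ ((f , f∈ , j) ◅ r) =
    reachable-∈V {H} (incident-∈V H f∈ (joins⇒incident (joins-sym {f} j))) r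

  joins-∉ : ∀ {f u v S} → Joins f u v → u ∉ S → v ∉ S → end₁ f ∉ S × end₂ f ∉ S
  joins-∉ (inj₁ (refl , refl)) p q = p , q
  joins-∉ (inj₂ (refl , refl)) p q = q , p

  spanned : 𝔽 size → Subgraph G
  spanned X = record
    { V      = ⟦ touched? ⟧
    ; E      = tabulate X
    ; closed = λ {f} f∈ → let xf = trans (sym (lookup∘tabulate X f)) (∈⇒≡ f∈) in
        ∈-⟦⟧⁺ touched? (f , xf , inj₁ refl) , ∈-⟦⟧⁺ touched? (f , xf , inj₂ refl)
    }
    where
    touched? : Decidable (λ v → ∃[ f ] X f ≡ true × Incident f v)
    touched? v = any? λ f → (X f Bool.≟ true) ×-dec incident? f v

  spanned-∈E : ∀ {X f} → X f ≡ true → f ∈ E (spanned X)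
  spanned-∈E {X} {f} xf = ≡⇒∈ (trans (lookup∘tabulate X f) xf)

  spanned-∈V⁻ : ∀ {X v} → v ∈ V (spanned X) → ∃[ f ] X f ≡ true × Incident f v
  spanned-∈V⁻ {X} = ∈-⟦⟧⁻ (λ v → any? λ f → (X f Bool.≟ true) ×-dec incident? f v)

  ∨-true : ∀ {a b} → a ∨ b ≡ true → a ≡ true ⊎ b ≡ true
  ∨-true {true}  _ = inj₁ refl
  ∨-true {false} p = inj₂ p

  module _ {X : 𝔽 size} (circuit : Circuit cycles X) where

    private
      H = spanned X

      -- Otherwise the edges of X meeting the set reached from u would form a smaller cycle.
      reaches : ∀ (K : Subgraph G) {u v g h y} →
        (∀ f x w → X f ≡ true → Joins f x w → Reachable K u x → Reachable K u w ⊎ w ≡ v) →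
        ¬ Reachable K u v → X g ≡ true → Incident g u →
        X h ≡ true → Joins h v y → Reachable K u y
      reaches K {u} {v} {g} {h} {y} leaves v∉ xg gu xh hvy = from (∨-true (trans (sym (cong (_∧ (S (end₁ h) ∨ S (end₂ h))) xh)) (trans (Y≗X h) xh)))
        where
        S : 𝔽 order
        S x = does (reachable? K u x)
        S⁺ : ∀ {x} → Reachable K u x → S x ≡ true
        S⁺ {x} = dec-true (reachable? K u x)
        S⁻ : ∀ x → S x ≡ true → Reachable K u x
        S⁻ x = from-does (reachable? K u x)
        S∨ : ∀ f → Incident f u → S (end₁ f) ∨ S (end₂ f) ≡ true
        S∨ f (inj₁ refl) = cong (_∨ S (end₂ f)) (S⁺ ε)
        S∨ f (inj₂ refl) = trans (cong (S (end₁ f) ∨_) (S⁺ ε)) (Bool.∨-zeroʳ _)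
        Y≗X : (λ f → X f ∧ (S (end₁ f) ∨ S (end₂ f))) ≗ X
        Y≗X = circuit-≗ cycles {i = g} circuit
          (cut (proj₁ circuit) S v (dec-false (reachable? K u v) v∉) λ f x w xf j sx → go (leaves f x w xf j (S⁻ x sx)))
          (λ f p → Bool.∧-conicalˡ _ _ p) (cong₂ _∧_ xg (S∨ g gu))
          where
          go : ∀ {w} → Reachable K u w ⊎ w ≡ v → S w ≡ true ⊎ w ≡ v
          go (inj₁ r) = inj₁ (S⁺ r)
          go (inj₂ p) = inj₂ p
        from : S (end₁ h) ≡ true ⊎ S (end₂ h) ≡ true → Reachable K u y
        from (inj₁ p) with joins-unique {h} hvy (inj₁ refl)
        ... | inj₁ refl = ⊥-elim (v∉ (S⁻ _ p))
        ... | inj₂ refl = S⁻ _ p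
        from (inj₂ p) with joins-unique {h} hvy (inj₂ refl)
        ... | inj₁ refl = ⊥-elim (v∉ (S⁻ _ p))
        ... | inj₂ refl = S⁻ _ p

      connected : Connected H
      connected = nonempty , reach
        where
        nonempty : _
        nonempty with proj₁ (proj₂ circuit)
        ... | g , xg = end₁ g , proj₁ (closed H (spanned-∈E xg))
        reach : ∀ {u v} → u ∈ V H → v ∈ V H → Reachable H u v
        reach {u} {v} u∈ v∈ with reachable? H u v | spanned-∈V⁻ {X} u∈ | spanned-∈V⁻ {X} v∈
        ... | yes r | _ | _ = r
        ... | no ¬r | g , xg , gu | h , xh , hv with incident⇒joins {h} hv
        ...   | y , j = reaches H (λ f x w xf j r → inj₁ (r ◅◅ ((f , spanned-∈E xf , j) ◅ ε))) ¬r xg gu xh j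
                          ◅◅ ((h , spanned-∈E xh , joins-sym {h} j) ◅ ε)

      -- If g is a loop, it is a cycle and thus all of X, with degree 2 at v. Otherwise parity gives
      -- a second edge h at v; the far ends of g and h are joined by a walk that avoids v, and this
      -- walk with g and h is a cycle inside X, hence X. It has no further edge at v.
      degree-2 : ∀ {v} → v ∈ V H → deg X v ≡ 2
      degree-2 {v} v∈ with spanned-∈V⁻ {X} v∈
      ... | g , xg , gv with inc g v in ig
      ...   | false = trans (deg-cong (≗-sym δg≗X) v) (trans (deg-δ g v)
                        (cong₂ (λ a b → bit a + bit b) (trans (cong (λ x → δ x v) (proj₁ ends)) (δ-refl v))
                                                       (trans (cong (λ x → δ x v) (proj₂ ends)) (δ-refl v))))
        where
        ends : end₁ g ≡ v × end₂ g ≡ v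
        ends = inc-false gv ig
        δg≗X : δ g ≗ X
        δg≗X = circuit-≗ cycles {i = g} circuit
          (λ x → trans (∂-δ g x) (trans (cong (λ y → δ y x xor δ (end₂ g) x) (trans (proj₁ ends) (sym (proj₂ ends)))) (Bool.xor-same (δ (end₂ g) x))))
          (λ f p → subst (λ f → X f ≡ true) (δ⇒≡ g f p) xg) (δ-refl g)
      ...   | true with second-edge (proj₁ circuit v) xg ig
      ...     | h , h≢g , xh , ih with inc⇒joins {g} ig | inc⇒joins {h} ih
      ...       | x₁ , jg , v≢x₁ | x₂ , jh , v≢x₂ =
        trans (deg-split {X} {δ g} {δ h} split)
          (cong₂ _+_ (trans (deg-δ g v) (single g ig)) (trans (deg-δ h v) (single h ih)))
        where
        K = H ∖ ⁅ v ⁆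
        single : ∀ g → inc g v ≡ true → end-bits g v ≡ 1
        single g p with δ (end₁ g) v | δ (end₂ g) v
        ... | true  | false = refl
        ... | false | true  = refl
        ∉v : ∀ {x} → v ≢ x → x ∉ ⁅ v ⁆
        ∉v v≢x p = v≢x (sym (x∈⁅y⁆⇒x≡y v p))
        off-v : ∀ {x} → Reachable K x₁ x → v ≢ x
        off-v {x} r refl = proj₂ (∖-∈V⁻ {H} {⁅ v ⁆} (reachable-∈V {K} x₁∈K r)) (x∈⁅x⁆ v)
          where
          x₁∈K = x∈p∩q⁺ (incident-∈V H (spanned-∈E xg) (joins⇒incident (joins-sym {g} jg)) , x∉p⇒x∈∁p (∉v v≢x₁))
        leaves : ∀ f x w → X f ≡ true → Joins f x w → Reachable K x₁ x → Reachable K x₁ w ⊎ w ≡ v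
        leaves f x w xf j r with w ≟ v
        ... | yes p  = inj₂ p
        ... | no w≢v with joins-∉ {f} j (∉v (off-v r)) (∉v (w≢v ∘ sym))
        ...   | p , q = inj₁ (r ◅◅ ((f , ∖-∈E {H} (spanned-∈E xf) p q , j) ◅ ε))
        x₁↝x₂ : Reachable K x₁ x₂
        x₁↝x₂ = reaches K leaves (λ r → off-v r refl) xg (joins⇒incident (joins-sym {g} jg)) xh jh
        p = proj₁ (walk {K} x₁↝x₂)
        p⊆K = proj₁ (proj₂ (walk {K} x₁↝x₂))
        ∂p = proj₂ (proj₂ (walk {K} x₁↝x₂))
        O = p ⊕ δ g ⊕ δ h
        ∂O : ∂ O ≗ ∅
        ∂O x = trans (∂-extend jg jh ∂p x) (Bool.xor-same (δ v x))
        p⊆X : ∀ f → p f ≡ true → X f ≡ true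
        p⊆X f pf = trans (sym (lookup∘tabulate X f)) (∈⇒≡ (∖-∈E⁻ {H} {⁅ v ⁆} (p⊆K f pf)))
        O⊆X : O ⊆ᶠ X
        O⊆X f of with p f in pf | g ≟ f | h ≟ f
        ... | true  | _        | _        = p⊆X f pf
        ... | false | yes refl | _        = xg
        ... | false | no _     | yes refl = xh
        pv : ∀ f → Incident f v → p f ≡ false
        pv f i with p f in pf
        ... | false = refl
        ... | true  = ⊥-elim (proj₂ (∖-∈V⁻ {H} {⁅ v ⁆} (incident-∈V K (p⊆K f pf) i)) (x∈⁅x⁆ v))
        O≗X : O ≗ X
        O≗X = circuit-≗ cycles {i = g} circuit ∂O O⊆X
                (cong₂ _xor_ (cong₂ _xor_ (pv g gv) (δ-refl g)) (δ-≢ h≢g))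
        split : ∀ f → Incident f v → bit (X f) ≡ bit (δ g f) + bit (δ h f)
        split f i = trans (cong bit (trans (sym (O≗X f)) (cong (λ b → (b xor δ g f) xor δ h f) (pv f i)))) (lem (g ≟ f) (h ≟ f))
          where
          lem : ∀ (a : Dec (g ≡ f)) (b : Dec (h ≡ f)) → bit (does a xor does b) ≡ bit (does a) + bit (does b)
          lem (yes refl) (yes h≡g) = ⊥-elim (h≢g h≡g)
          lem (yes _) (no _)  = refl
          lem (no _)  (yes _) = refl
          lem (no _)  (no _)  = refl

    circuit⇒circle : IsCircle (spanned X)
    circuit⇒circle = connected , λ {v} v∈ →
      trans (degree-deg H v) (trans (deg-cong (lookup∘tabulate X) v) (degree-2 v∈))

module Signs (Γ : SignedGraph) where
  open SignedGraph Γ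

  s : 𝔽 size → Sign
  s X = Σˢ.sum λ f → if X f then σ f else ⊹

  s-cong : ∀ {X Y} → X ≗ Y → s X ≡ s Y
  s-cong eq = Σˢ.sum-cong-≗ λ f → cong (if_then σ f else ⊹) (eq f)

  s-⊕ : ∀ X Y → s (X ⊕ Y) ≡ s X · s Y
  s-⊕ X Y = trans (Σˢ.sum-cong-≗ λ f → lem (X f) (Y f) (σ f))
              (Σˢ.∑-distrib-+ (λ f → if X f then σ f else ⊹) (λ f → if Y f then σ f else ⊹))
    where
    lem : ∀ x y t → (if x xor y then t else ⊹) ≡ (if x then t else ⊹) · (if y then t else ⊹)
    lem true  true  ⊹ = refl
    lem true  true  ⊖ = refl
    lem true  false ⊹ = refl
    lem true  false ⊖ = refl
    lem false y     t = refl

-- Contracting C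

-- The cycle space of G / C is encoded by the edge sets disjoint from C that are even off C.
module Contraction (G : Graph) (C : Subgraph G) (circle : IsCircle C) where
  open Graph G
  open Incidence G
  open Circles G

  quotient : Subspace size
  quotient = record
    { Mem   = λ X → (∀ f → lookup (E C) f ≡ true → X f ≡ false) × (∀ v → lookup (V C) v ≡ false → ∂ X v ≡ false)
    ; Mem?  = λ X → all? (λ f → (lookup (E C) f Bool.≟ true) →-dec (X f Bool.≟ false))
                ×-dec all? (λ v → (lookup (V C) v Bool.≟ false) →-dec (∂ X v Bool.≟ false))
    ; ⊕-mem = λ {X} {Y} (p , q) (p′ , q′) → (λ f c → cong₂ _xor_ (p f c) (p′ f c)) ,
                λ v c → trans (∂-⊕ X Y v) (cong₂ _xor_ (q v c) (q′ v c))
    ; resp  = λ eq (p , q) → (λ f c → trans (sym (eq f)) (p f c)) , λ v c → trans (sym (∂-cong eq v)) (q v c)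
    ; ∅-mem = (λ _ _ → refl) , λ v _ → ∂-∅ v
    }

  ∉V⇒∉E : ∀ {f v} → v ∉ V C → Incident f v → lookup (E C) f ≡ false
  ∉V⇒∉E v∉ i = ∉⇒≡ λ f∈ → v∉ (incident-∈V C f∈ i)

  quotient-project : ∀ {O} → ∂ O ≗ ∅ → Subspace.Mem quotient (O ∖ᶠ lookup (E C))
  quotient-project {O} ∂O = (λ f c → trans (cong (λ b → O f ∧ not b) c) (Bool.∧-zeroʳ (O f))) , λ v c →
    trans (∂-local {Y = O} λ f i → trans (cong (λ b → O f ∧ not b) (∉V⇒∉E (≡⇒∉ c) i)) (Bool.∧-identityʳ (O f))) (∂O v)

  -- Each odd vertex v of X lies on C and is joined to a fixed vertex r inside C; by the handshake
  -- lemma the walks used meet r evenly.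
  abstract
    quotient-lift : ∀ {X} → Subspace.Mem quotient X →
      ∃[ T ] ∂ T ≗ ∅ × (∀ f → lookup (E C) f ≡ false → T f ≡ X f)
    quotient-lift {X} (_ , ∂X) = X ⊕ A , ∂T , λ f c → trans (cong (X f xor_) (A-off f c)) (Bool.xor-identityʳ (X f))
      where
      r : Vertex
      r = proj₁ (proj₁ (proj₁ circle))
      r∈ : r ∈ V C
      r∈ = proj₂ (proj₁ (proj₁ circle))
      tail : ∀ v → ∃[ p ] (∀ f → lookup (E C) f ≡ false → p f ≡ false) × (v ∈ V C → ∀ x → ∂ p x ≡ δ v x xor δ r x)
      tail v with v ∈? V C
      ... | no v∉ = ∅ , (λ _ _ → refl) , λ v∈ → ⊥-elim (v∉ v∈)
      ... | yes v∈ with walk {C} (proj₂ (proj₁ circle) v∈ r∈)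
      ...   | p , p⊆ , ∂p = p , (λ f c → off f c) , λ _ → ∂p
        where
        off : ∀ f → lookup (E C) f ≡ false → p f ≡ false
        off f c with p f in pf
        ... | false = refl
        ... | true  = ⊥-elim (≡⇒∉ c (p⊆ f pf))
      P : Vertex → 𝔽 size
      P v = proj₁ (tail v)
      A : 𝔽 size
      A f = Σᵇ.sum λ v → ∂ X v ∧ P v f
      A-off : ∀ f → lookup (E C) f ≡ false → A f ≡ false
      A-off f c = Σᵇ-zero λ v → trans (cong (∂ X v ∧_) (proj₁ (proj₂ (tail v)) f c)) (Bool.∧-zeroʳ (∂ X v))
      term : ∀ x v → ∂ X v ∧ ∂ (P v) x ≡ (∂ X v ∧ δ v x) xor (∂ X v ∧ δ r x)
      term x v = go (v ∈? V C)
        where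
        go : Dec (v ∈ V C) → ∂ X v ∧ ∂ (P v) x ≡ (∂ X v ∧ δ v x) xor (∂ X v ∧ δ r x)
        go (yes v∈) = trans (cong (∂ X v ∧_) (proj₂ (proj₂ (tail v)) v∈ x)) (Bool.∧-distribˡ-xor (∂ X v) (δ v x) (δ r x))
        go (no v∉) rewrite ∂X v (∉⇒≡ v∉) = refl
      ∂A : ∀ x → ∂ A x ≡ ∂ X x
      ∂A x = trans (Σᵇ.sum-cong-≗ λ f → Σᵇ.*-distribʳ-sum (inc f x) (λ v → ∂ X v ∧ P v f))
        (trans (Σᵇ.∑-comm λ f v → (∂ X v ∧ P v f) ∧ inc f x)
        (trans (Σᵇ.sum-cong-≗ λ v → trans (Σᵇ.sum-cong-≗ λ f → Bool.∧-assoc (∂ X v) (P v f) (inc f x))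
                                      (trans (sym (Σᵇ.*-distribˡ-sum (∂ X v) λ f → P v f ∧ inc f x)) (term x v)))
        (trans (Σᵇ.∑-distrib-+ (λ v → ∂ X v ∧ δ v x) (λ v → ∂ X v ∧ δ r x))
        (trans (cong₂ _xor_ at-x at-r) (Bool.xor-identityʳ (∂ X x))))))
        where
        at-x : Σᵇ.sum (λ v → ∂ X v ∧ δ v x) ≡ ∂ X x
        at-x = trans (Σᵇ-support x λ v v≢x → trans (cong (∂ X v ∧_) (δ-≢ v≢x)) (Bool.∧-zeroʳ (∂ X v)))
                 (trans (cong (∂ X x ∧_) (δ-refl x)) (Bool.∧-identityʳ (∂ X x)))
        at-r : Σᵇ.sum (λ v → ∂ X v ∧ δ r x) ≡ false
        at-r = trans (sym (Σᵇ.*-distribʳ-sum (δ r x) (∂ X))) (cong (_∧ δ r x) (handshake X))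
      ∂T : ∂ (X ⊕ A) ≗ ∅
      ∂T x = trans (∂-⊕ X A x) (trans (cong (∂ X x xor_) (∂A x)) (Bool.xor-same (∂ X x)))

module Bridges (G : Graph) (connected : Connected (whole G)) (no-cut : NoCutpoint (whole G))
               (C : Subgraph G) (circle : IsCircle C) where
  open Graph G
  open Incidence G
  open Circles G
  open Contraction G C circle

  -- This is what excluding the loop clause of `IsCutpoint` gives.
  no-loop : ∀ {l f v} → Joins l v v → Incident f v → f ≡ l
  no-loop {l} {f} {v} j i with f ≟ l
  ... | yes p  = p
  ... | no f≢l = ⊥-elim (no-cut v (∈⊤ , inj₂ (l , f , ∈⊤ , j , ∈⊤ , i , f≢l)))

  ≢⇒∉ : ∀ {w x : Vertex} → x ≢ w → x ∉ ⁅ w ⁆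
  ≢⇒∉ {w} x≢w p = x≢w (x∈⁅y⁆⇒x≡y w p)

  avoiding : ∀ {w x y} → x ≢ w → y ≢ w → Reachable (whole G ∖ ⁅ w ⁆) x y
  avoiding {w} {x} {y} x≢w y≢w with reachable? (whole G ∖ ⁅ w ⁆) x y
  ... | yes r = r
  ... | no ¬r = ⊥-elim (no-cut w (∈⊤ , inj₁ (x , y , in-rest x≢w , in-rest y≢w , proj₂ connected ∈⊤ ∈⊤ , ¬r)))
    where
    in-rest : ∀ {x} → x ≢ w → x ∈ V (whole G ∖ ⁅ w ⁆)
    in-rest x≢w = x∈p∩q⁺ (∈⊤ , x∉p⇒x∈∁p (≢⇒∉ x≢w))

  open Subspace quotient

  abstract
    -- As w is no cutpoint, the far ends of g and h are joined by a walk that avoids w, and g and h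
    -- close it to a cycle with no other edge at w. A circuit of G / C through g inside that cycle
    -- contains h as well, because w is off C and must be even.
    circuit-through-corner : ∀ {w g h} → w ∉ V C → Incident g w → Incident h w → g ≢ h →
      ∃[ Y ] Circuit quotient Y × Y g ≡ true × Y h ≡ true
    circuit-through-corner {w} {g} {h} w∉ gw hw g≢h with incident⇒joins {g} gw | incident⇒joins {h} hw
    ... | x₁ , jg | x₂ , jh = Y , cY , yg , yh
      where
      x₁≢w : x₁ ≢ w
      x₁≢w refl = g≢h (sym (no-loop {g} {h} jg hw))
      x₂≢w : x₂ ≢ w
      x₂≢w refl = g≢h (no-loop {h} {g} jh gw)
      K : Subgraph G
      K = whole G ∖ ⁅ w ⁆
      the-walk : ∃[ p ] (∀ f → p f ≡ true → f ∈ E K) × (∀ x → ∂ p x ≡ δ x₁ x xor δ x₂ x)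
      the-walk = walk {K} (avoiding x₁≢w x₂≢w)
      p : 𝔽 size
      p = proj₁ the-walk
      O : 𝔽 size
      O = p ⊕ δ g ⊕ δ h
      ∂O : ∂ O ≗ ∅
      ∂O x = trans (∂-extend jg jh (proj₂ (proj₂ the-walk)) x) (Bool.xor-same (δ w x))
      pw : ∀ f → Incident f w → p f ≡ false
      pw f i with p f in pf
      ... | false = refl
      ... | true  = ⊥-elim (proj₂ (∖-∈V⁻ {whole G} {⁅ w ⁆} (incident-∈V K (proj₁ (proj₂ the-walk) f pf) i)) (x∈⁅x⁆ w))
      Og : (O ∖ᶠ lookup (E C)) g ≡ true
      Og = cong₂ _∧_ (cong₂ _xor_ (cong₂ _xor_ (pw g gw) (δ-refl g)) (δ-≢ (g≢h ∘ sym))) (cong not (∉V⇒∉E w∉ gw))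
      found : ∃[ Y ] Circuit quotient Y × Y ⊆ᶠ O ∖ᶠ lookup (E C) × Y g ≡ true
      found = circuitIn quotient {i = g} (quotient-project ∂O) Og
      Y : 𝔽 size
      Y = proj₁ found
      cY : Circuit quotient Y
      cY = proj₁ (proj₂ found)
      yg : Y g ≡ true
      yg = proj₂ (proj₂ (proj₂ found))
      only : ∀ f → Y f ≡ true → Incident f w → f ≡ g ⊎ f ≡ h
      only f yf i = pick (g ≟ f) (h ≟ f) (trans (cong (λ b → (b xor δ g f) xor δ h f) (sym (pw f i)))
                      (Bool.∧-conicalˡ (O f) _ (proj₁ (proj₂ (proj₂ found)) f yf)))
        where
        pick : (a : Dec (g ≡ f)) (b : Dec (h ≡ f)) → does a xor does b ≡ true → f ≡ g ⊎ f ≡ h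
        pick (yes g≡f) _         _ = inj₁ (sym g≡f)
        pick (no _)    (yes h≡f) _ = inj₂ (sym h≡f)
      yh : Y h ≡ true
      yh = pair-at {Y} {w} {g} {h} (proj₂ (proj₁ cY) w (∉⇒≡ w∉)) yg (inc-true {g} jg (x₁≢w ∘ sym)) only

  -- Bridges are the classes generated by sharing a vertex off C, so such a property holds on all
  -- edges of a bridge or on none.
  Spreads : (Edge → Set) → Set
  Spreads K = ∀ {w f g} → w ∉ V C → Incident f w → Incident g w → K f → K g

  -- What the ear arguments use of the edge set of a bridge, uniformly for chords and components:
  -- `saturated` and `linked` make it one class under meeting off C, and `open-arc` is a cycle of G
  -- / C that is not one of G, the source of an ear.
  record BridgeSet (D : 𝔽 size) : Set₁ where
    field
      off-C     : ∀ f → lookup (E C) f ≡ true → D f ≡ false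
      saturated : Spreads (λ f → D f ≡ true)
      linked    : ∀ {K : Edge → Set} → Spreads K → ∀ {f g} → D f ≡ true → D g ≡ true → K f → K g
      open-arc  : ∃[ p ] p ⊆ᶠ D × Mem p × ¬ (∂ p ≗ ∅)

    -- A vertex off C has either all of its edges in D or none, so the part of W in D is even there.
    -- This makes a bridge a separator of G / C.
    restrict : ∀ {W} → Mem W → Mem (λ f → W f ∧ D f)
    restrict {W} (p , q) = (λ f c → cong (_∧ D f) (p f c)) , at
      where
      at : ∀ v → lookup (V C) v ≡ false → ∂ (λ f → W f ∧ D f) v ≡ false
      at v c with any? (λ f → (D f Bool.≟ true) ×-dec incident? f v)
      ... | yes (f , df , i) = trans (∂-local {Y = W} λ g j →
                trans (cong (W g ∧_) (saturated (≡⇒∉ c) i j df)) (Bool.∧-identityʳ (W g))) (q v c)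
      ... | no ¬p = trans (∂-local {Y = ∅} λ g j → trans (cong (W g ∧_) (Bool.¬-not λ dg → ¬p (g , dg , j)))
                (Bool.∧-zeroʳ (W g))) (∂-∅ v)

    circuit-⊆ : ∀ {X f} → Circuit quotient X → X f ≡ true → D f ≡ true → X ⊆ᶠ D
    circuit-⊆ {X} {f} cX xf df g xg = Bool.∧-conicalʳ (X g) (D g) (trans
      (circuit-≗ quotient {i = f} cX (restrict (proj₁ cX)) (λ h → Bool.∧-conicalˡ (X h) (D h)) (cong₂ _∧_ xf df) g) xg)

-- The bridges of C

module Components (G : Graph) (connected : Connected (whole G)) (no-cut : NoCutpoint (whole G))
                  (C : Subgraph G) (circle : IsCircle C) where
  open Graph G
  open Incidence G
  open Circles G
  open Contraction G C circle
  open Bridges G connected no-cut C circle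
  open Equivalence

  H : Subgraph G
  H = whole G ∖ V C

  ∈E-H : ∀ {f u v} → Joins f u v → u ∉ V C → v ∉ V C → f ∈ E H
  ∈E-H {f} j u∉ v∉ = ∖-∈E {whole G} ∈⊤ (proj₁ (joins-∉ {f} j u∉ v∉)) (proj₂ (joins-∉ {f} j u∉ v∉))

  ∉V-H : ∀ {v} → v ∈ V H → v ∉ V C
  ∉V-H v∈ = proj₂ (∖-∈V⁻ {whole G} {V C} v∈)

  component-E? : ∀ d → Decidable (λ f → f ∈ E H × Reachable H d (end₁ f))
  component-E? d f = (f ∈? E H) ×-dec reachable? H d (end₁ f)

  componentOf : Vertex → Subgraph G
  componentOf d = record
    { V      = ⟦ reachable? H d ⟧
    ; E      = ⟦ component-E? d ⟧
    ; closed = λ {f} f∈ → let (f∈H , r) = ∈-⟦⟧⁻ (component-E? d) f∈ in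
        ∈-⟦⟧⁺ (reachable? H d) r , ∈-⟦⟧⁺ (reachable? H d) (r ◅◅ ((f , f∈H , inj₁ (refl , refl)) ◅ ε))
    }

  module _ {d : Vertex} where

    componentOf-V⁺ : ∀ {v} → Reachable H d v → v ∈ V (componentOf d)
    componentOf-V⁺ = ∈-⟦⟧⁺ (reachable? H d)

    componentOf-V⁻ : ∀ {v} → v ∈ V (componentOf d) → Reachable H d v
    componentOf-V⁻ = ∈-⟦⟧⁻ (reachable? H d)

    componentOf-E⁺ : ∀ {f v} → f ∈ E H → Reachable H d v → Incident f v → f ∈ E (componentOf d)
    componentOf-E⁺ f∈ r (inj₁ refl) = ∈-⟦⟧⁺ (component-E? d) (f∈ , r)
    componentOf-E⁺ {f} f∈ r (inj₂ refl) = ∈-⟦⟧⁺ (component-E? d) (f∈ , (r ◅◅ ((f , f∈ , inj₂ (refl , refl)) ◅ ε)))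

    componentOf-connected : Connected (componentOf d)
    componentOf-connected = (d , componentOf-V⁺ ε) , λ u∈ v∈ →
      inside (componentOf-V⁻ u∈) (reachable-sym {H} (componentOf-V⁻ u∈) ◅◅ componentOf-V⁻ v∈)
      where
      inside : ∀ {u v} → Reachable H d u → Reachable H u v → Reachable (componentOf d) u v
      inside r ε = ε
      inside r ((f , f∈ , j) ◅ p) = (f , componentOf-E⁺ f∈ r (joins⇒incident j) , j) ◅ inside (r ◅◅ ((f , f∈ , j) ◅ ε)) p

    componentOf-⊑ : d ∈ V H → componentOf d ⊑ H
    componentOf-⊑ d∈ = (λ v∈ → reachable-∈V {H} d∈ (componentOf-V⁻ v∈)) , λ f∈ → proj₁ (∈-⟦⟧⁻ (component-E? d) f∈)

    reachable-mono : ∀ {K L : Subgraph G} → K ⊑ L → ∀ {u v} → Reachable K u v → Reachable L u v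
    reachable-mono K⊑L ε = ε
    reachable-mono {K} {L} K⊑L ((f , f∈ , j) ◅ r) = (f , proj₂ K⊑L f∈ , j) ◅ reachable-mono {K} {L} K⊑L r

    ⊑-componentOf : ∀ {K} → K ⊑ H → Connected K → d ∈ V K → K ⊑ componentOf d
    ⊑-componentOf {K} K⊑H (_ , reach) d∈ =
      (λ v∈ → componentOf-V⁺ (reachable-mono {K} {H} K⊑H (reach d∈ v∈))) ,
      (λ {f} f∈ → componentOf-E⁺ (proj₂ K⊑H f∈) (reachable-mono {K} {H} K⊑H (reach d∈ (proj₁ (closed K f∈)))) (inj₁ refl))

    componentOf-isComponent : d ∈ V H → IsComponent H (componentOf d)
    componentOf-isComponent d∈ = componentOf-⊑ d∈ , componentOf-connected , λ K K⊑H cK D⊑K →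
      ⊑-componentOf {K} K⊑H cK (proj₁ D⊑K (componentOf-V⁺ ε))

  componentOf-least : ∀ {D d} → IsComponent H D → d ∈ V D → componentOf d ⊑ D
  componentOf-least {D} {d} (D⊑H , cD , max) d∈ =
    max (componentOf d) (componentOf-⊑ (proj₁ D⊑H d∈)) componentOf-connected (⊑-componentOf {d} {D} D⊑H cD d∈)

  components-meet : ∀ {D D′ d} → IsComponent H D → IsComponent H D′ → d ∈ V D → d ∈ V D′ → D ⊑ D′
  components-meet {D} {D′} {d} cD cD′ d∈ d∈′ =
    (λ v∈ → proj₁ lower (proj₁ upper v∈)) , (λ f∈ → proj₂ lower (proj₂ upper f∈))
    where
    upper = ⊑-componentOf {d} {D} (proj₁ cD) (proj₁ (proj₂ cD)) d∈
    lower = componentOf-least {D′} cD′ d∈′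

  module ComponentBridge {D B : Subgraph G} (isC : IsComponent H D)
    (E⇔ : ∀ f → f ∈ E B ⇔ (f ∈ E D ⊎ JoinsTo D C f)) where

    D∉C : ∀ {v} → v ∈ V D → v ∉ V C
    D∉C v∈ = ∉V-H (proj₁ (proj₁ isC) v∈)

    inner-end : ∀ {f} → f ∈ E B → ∃[ v ] v ∈ V D × Incident f v
    inner-end {f} f∈ with to (E⇔ f) f∈
    ... | inj₁ f∈D = end₁ f , proj₁ (closed D f∈D) , inj₁ refl
    ... | inj₂ (u , v , u∈ , _ , j) = u , u∈ , joins⇒incident {f} j

    inner-edge : ∀ {f d v} → d ∈ V D → Joins f d v → v ∉ V C → f ∈ E D
    inner-edge {f} {d} d∈ j v∉ =
      proj₂ (componentOf-least {D} isC d∈) (componentOf-E⁺ (∈E-H {f} j (D∉C d∈) v∉) ε (joins⇒incident {f} j))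

    at-inner : ∀ {f d} → d ∈ V D → Incident f d → f ∈ E B
    at-inner {f} d∈ i with incident⇒joins {f} i
    ... | v , j with v ∈? V C
    ...   | yes v∈ = from (E⇔ f) (inj₂ (_ , v , d∈ , v∈ , j))
    ...   | no v∉  = from (E⇔ f) (inj₁ (inner-edge {f} d∈ j v∉))

    inner-at : ∀ {f w} → w ∉ V C → Incident f w → f ∈ E B → w ∈ V D
    inner-at {f} w∉ i f∈ with to (E⇔ f) f∈
    ... | inj₁ f∈D = incident-∈V D f∈D i
    ... | inj₂ (u , v , u∈ , v∈ , j) with joins-unique {f} j i
    ...   | inj₁ refl = u∈
    ...   | inj₂ refl = ⊥-elim (w∉ v∈)

    -- The property that all edges at a vertex satisfy K is carried along a walk in D, whose
    -- vertices are all off C.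
    component-linked : ∀ {K : Edge → Set} → Spreads K → ∀ {f g} → f ∈ E B → g ∈ E B → K f → K g
    component-linked {K} spread {f} {g} f∈ g∈ kf with inner-end f∈ | inner-end g∈
    ... | d , d∈ , i | d′ , d∈′ , i′ =
      along (proj₂ (proj₁ (proj₂ isC)) d∈ d∈′) d∈ (λ h i″ → spread (D∉C d∈) i i″ kf) g i′
      where
      along : ∀ {u v} → Reachable D u v → u ∈ V D → (∀ h → Incident h u → K h) → ∀ h → Incident h v → K h
      along ε _ full = full
      along ((f , f∈ , j) ◅ r) _ full = along r w∈ λ h i → spread (D∉C w∈) (joins⇒incident (joins-sym {f} j)) i
                                          (full f (joins⇒incident {f} j))
        where w∈ = incident-∈V D f∈ (joins⇒incident (joins-sym {f} j))

    -- Until the walk first steps onto C it cannot leave the component D.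
    exit : ∀ {K : Subgraph G} {d c} → Reachable K d c → d ∈ V D → c ∈ V C →
      ∃[ f ] ∃[ x ] ∃[ b ] f ∈ E K × x ∈ V D × b ∈ V C × Joins f x b
    exit ε d∈ c∈ = ⊥-elim (D∉C d∈ c∈)
    exit {K} {d} (_◅_ {j = w} (f , f∈ , j) r) d∈ c∈ with w ∈? V C
    ... | yes w∈ = f , d , w , f∈ , d∈ , w∈ , j
    ... | no w∉  = exit {K} r (incident-∈V D (inner-edge {f} d∈ j w∉) (joins⇒incident (joins-sym {f} j))) c∈

    -- An edge of C with both ends at a would be a loop, which in a block shares its vertex with no
    -- other edge; f would then be that loop.
    other-on-C : ∀ {a f} → f ∉ E C → Incident f a → ∃[ c ] c ∈ V C × c ≢ a
    other-on-C {a} {f} f∉ i with proj₁ (proj₂ (circle⇒circuit {C} circle))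
    ... | e , ee with end₁ e ≟ a | end₂ e ≟ a
    ...   | no p  | _     = end₁ e , proj₁ (closed C (≡⇒∈ ee)) , p
    ...   | _     | no p  = end₂ e , proj₂ (closed C (≡⇒∈ ee)) , p
    ...   | yes p | yes q = ⊥-elim (f∉ (subst (_∈ E C) (sym (no-loop {e} (inj₁ (p , q)) i)) (≡⇒∈ ee)))

    off : ∀ {f} → f ∈ E B → f ∉ E C
    off f∈ f∈C with inner-end f∈
    ... | v , v∈ , i = D∉C v∈ (incident-∈V C f∈C i)

    record Attachments : Set where
      field
        {f₁ f₂} : Edge
        {x₁ x₂ a b} : Vertex
        x₁∈ : x₁ ∈ V D
        x₂∈ : x₂ ∈ V D
        a∈ : a ∈ V C
        b∈ : b ∈ V C
        a≢b : a ≢ b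
        j₁ : Joins f₁ a x₁
        j₂ : Joins f₂ b x₂

      f₁∈ : f₁ ∈ E B
      f₁∈ = at-inner {f₁} x₁∈ (joins⇒incident (joins-sym {f₁} j₁))

      f₂∈ : f₂ ∈ E B
      f₂∈ = at-inner {f₂} x₂∈ (joins⇒incident (joins-sym {f₂} j₂))

    abstract
      -- The second edge is sought in G with a deleted, which still connects D to the rest of C
      -- because a is no cutpoint. Hence b differs from a.
      attachments : Attachments
      attachments with proj₁ (proj₁ (proj₂ isC)) | proj₁ (proj₁ circle)
      ... | d , d∈ | r , r∈ with exit {whole G} (proj₂ connected {d} {r} ∈⊤ ∈⊤) d∈ r∈
      ... | f₁ , x₁ , a , _ , x₁∈ , a∈ , j₁
        with other-on-C {a} (off (at-inner {f₁} x₁∈ (joins⇒incident {f₁} j₁))) (joins⇒incident (joins-sym {f₁} j₁))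
      ... | c , c∈ , c≢a
        with exit {whole G ∖ ⁅ a ⁆} (avoiding {a} {d} {c} (λ { refl → D∉C d∈ a∈ }) c≢a) d∈ c∈
      ... | f₂ , x₂ , b , f₂∈ , x₂∈ , b∈ , j₂ = record
        { x₁∈ = x₁∈ ; x₂∈ = x₂∈ ; a∈ = a∈ ; b∈ = b∈ ; a≢b = a≢b ; j₁ = joins-sym {f₁} j₁ ; j₂ = joins-sym {f₂} j₂ }
        where
        a≢b : a ≢ b
        a≢b refl = proj₂ (∖-∈V⁻ {whole G} {⁅ a ⁆} (incident-∈V (whole G ∖ ⁅ a ⁆) f₂∈ (joins⇒incident (joins-sym {f₂} j₂)))) (x∈⁅x⁆ a)

    bridgeSet : BridgeSet (lookup (E B))
    bridgeSet = record
      { off-C     = λ f c → ∉⇒≡ λ f∈ → off f∈ (≡⇒∈ c)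
      ; saturated = λ {w} {f} {g} w∉ i j f∈ → ∈⇒≡ (at-inner {g} (inner-at {f} w∉ i (≡⇒∈ f∈)) j)
      ; linked    = λ spread f∈ g∈ → component-linked spread (≡⇒∈ f∈) (≡⇒∈ g∈)
      ; open-arc  = q , q⊆ , ((λ f c → no-C f c) , λ v c → ∂q-off v c) , λ z → absurdᵇ (∂q-a) (z a)
      }
      where
      open Attachments attachments
      the-walk = walk {D} (proj₂ (proj₁ (proj₂ isC)) x₁∈ x₂∈)
      p = proj₁ the-walk
      -- An arc from a through D to b. Its only odd vertices are a and b, both on C, so it is a
      -- cycle of G / C but not of G.
      q : 𝔽 size
      q = p ⊕ δ f₁ ⊕ δ f₂
      q⊆ : q ⊆ᶠ lookup (E B)
      q⊆ f = pick (p f Bool.≟ true) (f₁ ≟ f) (f₂ ≟ f)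
        where
        pick : Dec (p f ≡ true) → (m : Dec (f₁ ≡ f)) (n : Dec (f₂ ≡ f)) →
          (p f xor does m) xor does n ≡ true → lookup (E B) f ≡ true
        pick (yes pf) _ _ _ = ∈⇒≡ (from (E⇔ f) (inj₁ (proj₁ (proj₂ the-walk) f pf)))
        pick (no _) (yes refl) _ _ = ∈⇒≡ f₁∈
        pick (no _) _ (yes refl) _ = ∈⇒≡ f₂∈
        pick (no ¬pf) (no _) (no _) z = ⊥-elim (¬pf (trans (sym (trans (Bool.xor-identityʳ _) (Bool.xor-identityʳ (p f)))) z))
      ∂q : ∀ x → ∂ q x ≡ δ a x xor δ b x
      ∂q = ∂-extend {p} j₁ j₂ (proj₂ (proj₂ the-walk))
      no-C : ∀ f → lookup (E C) f ≡ true → q f ≡ false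
      no-C f c = Bool.¬-not λ qf → off (≡⇒∈ (q⊆ f qf)) (≡⇒∈ c)
      ∂q-off : ∀ v → lookup (V C) v ≡ false → ∂ q v ≡ false
      ∂q-off v c = trans (∂q v) (cong₂ _xor_ (δ-≢ {i = a} λ { refl → ≡⇒∉ c a∈ }) (δ-≢ {i = b} λ { refl → ≡⇒∉ c b∈ }))
      ∂q-a : ∂ q a ≡ true
      ∂q-a = trans (∂q a) (cong₂ _xor_ (δ-refl a) (δ-≢ (a≢b ∘ sym)))

  chord-bridgeSet : ∀ {B e u v} → e ∉ E C → u ≢ v → u ∈ V C → v ∈ V C → IsEdgeJoining e u v B → BridgeSet (lookup (E B))
  chord-bridgeSet {B} {e} {u} {v} e∉ u≢v u∈ v∈ (j , _ , E≡) = record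
    { off-C     = λ f c → Bool.¬-not λ f∈ → e∉ (subst (_∈ E C) (only f∈) (≡⇒∈ c))
    ; saturated = λ {w} {f} w∉ i _ f∈ → ⊥-elim (on-C w∉ (joins-unique {e} j (subst (λ f → Incident f w) (only f∈) i)))
    ; linked    = λ {K} _ {f} {g} f∈ g∈ k → subst K (trans (only f∈) (sym (only g∈))) k
    ; open-arc  = δ e , (λ f p → trans (cong (λ S → lookup S f) E≡) (trans (lookup-⁅⁆ e f) (trans (cong (δ f) (δ⇒≡ e f p)) (δ-refl f))))
                , ((λ f c → δ-≢ {i = e} λ { refl → e∉ (≡⇒∈ c) }) , λ w c → trans (∂-δ e w) (inc-¬ λ i → on-C (≡⇒∉ c) (joins-unique {e} j i)))
                , λ z → absurdᵇ (trans (∂-δ e u) (inc-true {e} j u≢v)) (z u)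
    }
    where
    only : ∀ {f} → lookup (E B) f ≡ true → f ≡ e
    only f∈ = x∈⁅y⁆⇒x≡y e (subst (_ ∈_) E≡ (≡⇒∈ f∈))
    on-C : ∀ {w} → w ∉ V C → ¬ (w ≡ u ⊎ w ≡ v)
    on-C w∉ (inj₁ refl) = w∉ u∈
    on-C w∉ (inj₂ refl) = w∉ v∈

  bridge-set : ∀ {B} → IsBridge C B → BridgeSet (lookup (E B))
  bridge-set {B} (chord e∉ u≢v u∈ v∈ j) = chord-bridgeSet {B} e∉ u≢v u∈ v∈ j
  bridge-set {B} (component {D} isC E⇔ V⇔) = ComponentBridge.bridgeSet {D} {B} isC E⇔

  chord-ends : ∀ {B e u v f w} → u ∈ V C → v ∈ V C → IsEdgeJoining e u v B → f ∈ E B → Incident f w → w ∈ V C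
  chord-ends {e = e} {f = f} {w} u∈ v∈ (j , _ , E≡) f∈ i
    with joins-unique {e} j (subst (λ f → Incident f w) (x∈⁅y⁆⇒x≡y e (subst (f ∈_) E≡ f∈)) i)
  ... | inj₁ refl = u∈
  ... | inj₂ refl = v∈

  -- An edge of a component bridge has an end off C, which no chord has; and two components that
  -- share such an end coincide.
  bridges-meet : ∀ {B B′ f} → IsBridge C B → IsBridge C B′ → f ∈ E B → f ∈ E B′ → B ≐ B′
  bridges-meet {B} {B′} {f} (chord {e} {u} {v} _ _ _ _ (j , V≡ , E≡)) (chord {e′} {u′} {v′} _ _ _ _ (j′ , V≡′ , E≡′)) f∈ f∈′
    with x∈⁅y⁆⇒x≡y e (subst (f ∈_) E≡ f∈) | x∈⁅y⁆⇒x≡y e′ (subst (f ∈_) E≡′ f∈′)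
  ... | refl | refl = trans V≡ (trans (same j j′) (sym V≡′)) , trans E≡ (sym E≡′)
    where
    same : Joins f u v → Joins f u′ v′ → ⁅ u ⁆ ∪ ⁅ v ⁆ ≡ ⁅ u′ ⁆ ∪ ⁅ v′ ⁆
    same (inj₁ (refl , refl)) (inj₁ (refl , refl)) = refl
    same (inj₁ (refl , refl)) (inj₂ (refl , refl)) = ∪-comm ⁅ u ⁆ ⁅ v ⁆
    same (inj₂ (refl , refl)) (inj₁ (refl , refl)) = ∪-comm ⁅ u ⁆ ⁅ v ⁆
    same (inj₂ (refl , refl)) (inj₂ (refl , refl)) = refl
  bridges-meet {B} {B′} {f} (chord _ _ u∈ v∈ J) (component {D} isC E⇔ _) f∈ f∈′
    with ComponentBridge.inner-end {D} {B′} isC E⇔ f∈′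
  ... | d , d∈ , i = ⊥-elim (ComponentBridge.D∉C {D} {B′} isC E⇔ d∈ (chord-ends {B} u∈ v∈ J f∈ i))
  bridges-meet {B} {B′} {f} (component {D} isC E⇔ _) (chord _ _ u∈ v∈ J) f∈ f∈′
    with ComponentBridge.inner-end {D} {B} isC E⇔ f∈
  ... | d , d∈ , i = ⊥-elim (ComponentBridge.D∉C {D} {B} isC E⇔ d∈ (chord-ends {B′} u∈ v∈ J f∈′ i))
  bridges-meet {B} {B′} {f} (component {D} isC E⇔ V⇔) (component {D′} isC′ E⇔′ V⇔′) f∈ f∈′
    with ComponentBridge.inner-end {D} {B} isC E⇔ f∈
  ... | d , d∈ , i = ⊆-antisym (V⊆ {B} {B′} {D} {D′} V⇔ V⇔′ D⊑D′) (V⊆ {B′} {B} {D′} {D} V⇔′ V⇔ D′⊑D) ,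
      ⊆-antisym (E⊆ {B} {B′} {D} {D′} E⇔ E⇔′ D⊑D′) (E⊆ {B′} {B} {D′} {D} E⇔′ E⇔ D′⊑D)
    where
    d∈′ : d ∈ V D′
    d∈′ = ComponentBridge.inner-at {D′} {B′} isC′ E⇔′ (ComponentBridge.D∉C {D} {B} isC E⇔ d∈) i f∈′
    D⊑D′ = components-meet {D} {D′} isC isC′ d∈ d∈′
    D′⊑D = components-meet {D′} {D} isC′ isC d∈′ d∈
    joins⊆ : ∀ {D D′ : Subgraph G} → D ⊑ D′ → ∀ {f} → JoinsTo D C f → JoinsTo D′ C f
    joins⊆ D⊑ (u , v , u∈ , v∈ , j) = u , v , proj₁ D⊑ u∈ , v∈ , j
    E⊆ : ∀ {B B′ D D′ : Subgraph G} → (∀ f → f ∈ E B ⇔ (f ∈ E D ⊎ JoinsTo D C f)) →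
      (∀ f → f ∈ E B′ ⇔ (f ∈ E D′ ⊎ JoinsTo D′ C f)) → D ⊑ D′ → ∀ {f} → f ∈ E B → f ∈ E B′
    E⊆ {_} {_} {D} {D′} p p′ D⊑ {f} f∈ with to (p f) f∈
    ... | inj₁ q = from (p′ f) (inj₁ (proj₂ D⊑ q))
    ... | inj₂ q = from (p′ f) (inj₂ (joins⊆ {D} {D′} D⊑ q))
    V⊆ : ∀ {B B′ D D′ : Subgraph G} → (∀ x → x ∈ V B ⇔ (x ∈ V D ⊎ (∃[ f ] JoinsTo D C f × Incident f x))) →
      (∀ x → x ∈ V B′ ⇔ (x ∈ V D′ ⊎ (∃[ f ] JoinsTo D′ C f × Incident f x))) → D ⊑ D′ → ∀ {x} → x ∈ V B → x ∈ V B′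
    V⊆ {_} {_} {D} {D′} p p′ D⊑ {x} x∈ with to (p x) x∈
    ... | inj₁ q           = from (p′ x) (inj₁ (proj₁ D⊑ q))
    ... | inj₂ (f , q , i) = from (p′ x) (inj₂ (f , joins⊆ {D} {D′} D⊑ q , i))

  component-of : ∀ {f d} → d ∉ V C → Incident f d → ∃[ B ] IsBridge C B × f ∈ E B
  component-of {f} {d} d∉ i = B , component {D = D} isC (λ g → mk⇔ (∈-⟦⟧⁻ E?) (∈-⟦⟧⁺ E?)) (λ x → mk⇔ (∈-⟦⟧⁻ V?) (∈-⟦⟧⁺ V?)) ,
      ComponentBridge.at-inner {D} {B} isC (λ g → mk⇔ (∈-⟦⟧⁻ E?) (∈-⟦⟧⁺ E?)) (componentOf-V⁺ ε) i
    where
    D = componentOf d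
    isC : IsComponent H D
    isC = componentOf-isComponent (x∈p∩q⁺ (∈⊤ , x∉p⇒x∈∁p d∉))
    joins-to? : Decidable (JoinsTo D C)
    joins-to? g = any? λ u → any? λ v → (u ∈? V D) ×-dec (v ∈? V C) ×-dec joins? g u v
    E? : Decidable (λ g → g ∈ E D ⊎ JoinsTo D C g)
    E? g = (g ∈? E D) ⊎-dec joins-to? g
    V? : Decidable (λ x → x ∈ V D ⊎ (∃[ g ] JoinsTo D C g × Incident g x))
    V? x = (x ∈? V D) ⊎-dec any? λ g → joins-to? g ×-dec incident? g x
    ends : ∀ {g x} → g ∈ ⟦ E? ⟧ → Incident g x → x ∈ ⟦ V? ⟧
    ends {g} g∈ i with ∈-⟦⟧⁻ E? g∈
    ... | inj₁ g∈D = ∈-⟦⟧⁺ V? (inj₁ (incident-∈V D g∈D i))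
    ... | inj₂ j   = ∈-⟦⟧⁺ V? (inj₂ (g , j , i))
    B : Subgraph G
    B = record { V = ⟦ V? ⟧ ; E = ⟦ E? ⟧ ; closed = λ g∈ → ends g∈ (inj₁ refl) , ends g∈ (inj₂ refl) }

  -- Guarantees that a full list of bridges accounts for every edge off C.
  bridge-of : ∀ f → f ∉ E C → ∃[ B ] IsBridge C B × f ∈ E B
  bridge-of f f∉ with end₁ f ∈? V C | end₂ f ∈? V C
  ... | yes p | yes q = B , chord f∉ u≢v p q (inj₁ (refl , refl) , refl , refl) , x∈⁅x⁆ f
    where
    -- A loop at a vertex of C would have to be the edge of C found there.
    u≢v : end₁ f ≢ end₂ f
    u≢v u≡v with circle-edge-at {C} circle p
    ... | g , g∈ , i = f∉ (subst (_∈ E C) (no-loop {f} {g} (inj₁ (refl , sym u≡v)) i) g∈)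
    B : Subgraph G
    B = record
      { V      = ⁅ end₁ f ⁆ ∪ ⁅ end₂ f ⁆
      ; E      = ⁅ f ⁆
      ; closed = λ {g} g∈ → subst (λ g → end₁ g ∈ ⁅ end₁ f ⁆ ∪ ⁅ end₂ f ⁆ × end₂ g ∈ ⁅ end₁ f ⁆ ∪ ⁅ end₂ f ⁆)
          (sym (x∈⁅y⁆⇒x≡y f g∈)) (x∈p∪q⁺ (inj₁ (x∈⁅x⁆ _)) , x∈p∪q⁺ (inj₂ (x∈⁅x⁆ _)))
      }
  ... | yes _ | no q  = component-of q (inj₂ refl)
  ... | no p  | _     = component-of p (inj₁ refl)

-- Bridges that are paths

step-constant : ∀ {k} {A : Set} (f : Fin (suc k) → A) → (∀ j → f (inject₁ j) ≡ f (suc j)) → ∀ i → f i ≡ f zero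
step-constant f step zero = refl
step-constant {suc k} f step (suc i) = trans (step-constant (f ∘ suc) (step ∘ suc) i) (sym (step zero))

inject₁≢suc : ∀ {k} (i : Fin k) → inject₁ i ≢ suc i
inject₁≢suc i p = ℕ.1+n≢n (trans (sym (cong toℕ p)) (toℕ-inject₁ i))

module SimplePaths {G : Graph} (H : Subgraph G) where
  open Graph G
  open Incidence G

  -- Indexed in the same way as `IsPath`, into which its fields are finally copied.
  record SimplePath (u w : Vertex) : Set where
    field
      {length}  : ℕ
      vertex    : Fin (suc length) → Vertex
      edge      : Fin length → Edge
      injective : Injective _≡_ _≡_ vertex
      joins     : ∀ i → Joins (edge i) (vertex (inject₁ i)) (vertex (suc i))
      edge∈     : ∀ i → edge i ∈ E H
      start     : vertex zero ≡ u
      end       : vertex (fromℕ length) ≡ w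

  open SimplePath

  drop : ∀ {u w} (P : SimplePath u w) i → SimplePath (vertex P i) w
  drop P i = go (length P) (vertex P) (edge P) (injective P) (joins P) (edge∈ P) (end P) i
    where
    go : ∀ k {w} (v : Fin (suc k) → Vertex) (η : Fin k → Edge) → Injective _≡_ _≡_ v →
      (∀ i → Joins (η i) (v (inject₁ i)) (v (suc i))) → (∀ i → η i ∈ E H) → v (fromℕ k) ≡ w →
      ∀ i → SimplePath (v i) w
    go k v η inj js e∈ end zero = record
      { vertex = v ; edge = η ; injective = inj ; joins = js ; edge∈ = e∈ ; start = refl ; end = end }
    go (suc k) v η inj js e∈ end (suc i) =
      go k (v ∘ suc) (η ∘ suc) (λ p → suc-injective (inj p)) (js ∘ suc) (e∈ ∘ suc) end i

  abstract
    simplePath : ∀ {u w} → Reachable H u w → SimplePath u w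
    simplePath {u} ε = record
      { length = 0 ; vertex = λ _ → u ; edge = λ () ; injective = λ { {zero} {zero} _ → refl }
      ; joins = λ () ; edge∈ = λ () ; start = refl ; end = refl }
    simplePath {u} ((f , f∈ , j) ◅ r) with simplePath r
    ... | P with any? (λ i → vertex P i ≟ u)
    -- The rest of the walk returns to u, so the detour before that return is cut off.
    ...   | yes (i , refl) = drop P i
    ...   | no u∉ = record { vertex = v ; edge = e ; injective = inj ; joins = js ; edge∈ = e∈ ; start = refl ; end = end P }
      where
      v : Fin (suc (suc (length P))) → Vertex
      v zero    = u
      v (suc i) = vertex P i
      e : Fin (suc (length P)) → Edge
      e zero    = f
      e (suc i) = edge P i
      inj : Injective _≡_ _≡_ v
      inj {zero}  {zero}  _ = refl
      inj {zero}  {suc j} p = ⊥-elim (u∉ (j , sym p))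
      inj {suc i} {zero}  p = ⊥-elim (u∉ (i , p))
      inj {suc i} {suc j} p = cong suc (injective P p)
      js : ∀ i → Joins (e i) (v (inject₁ i)) (v (suc i))
      js zero    = subst (Joins f u) (sym (start P)) j
      js (suc i) = joins P i
      e∈ : ∀ i → e i ∈ E H
      e∈ zero    = f∈
      e∈ (suc i) = edge∈ P i

  abstract
    edge-set : ∀ {u w} (P : SimplePath u w) →
      ∃[ p ] (∀ f → p f ≡ true → ∃[ i ] edge P i ≡ f) × (∀ x → ∂ p x ≡ δ u x xor δ w x)
    edge-set P with go (length P) (vertex P) (edge P) (joins P)
      where
      go : ∀ k (v : Fin (suc k) → Vertex) (η : Fin k → Edge) → (∀ i → Joins (η i) (v (inject₁ i)) (v (suc i))) →
        ∃[ p ] (∀ f → p f ≡ true → ∃[ i ] η i ≡ f) × (∀ x → ∂ p x ≡ δ (v zero) x xor δ (v (fromℕ k)) x)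
      go zero v η js = ∅ , (λ f ()) , λ x → trans (∂-∅ x) (sym (Bool.xor-same (δ (v zero) x)))
      go (suc k) v η js with go k (v ∘ suc) (η ∘ suc) (js ∘ suc)
      ... | p , p⊆ , ∂p = δ (η zero) ⊕ p , q⊆ , λ x →
            trans (∂-⊕ (δ (η zero)) p x) (trans (cong₂ _xor_ (trans (∂-δ (η zero) x) (inc-joins {η zero} (js zero) x)) (∂p x))
              (lem (δ (v zero) x) (δ (v (suc zero)) x) (δ (v (fromℕ (suc k))) x)))
        where
        lem : ∀ a b c → (a xor b) xor (b xor c) ≡ a xor c
        lem = solve 3 (λ a b c → (a :+ b) :+ (b :+ c) := a :+ c) refl
        q⊆ : ∀ f → (δ (η zero) ⊕ p) f ≡ true → ∃[ i ] η i ≡ f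
        q⊆ f q with η zero ≟ f
        ... | yes e = zero , e
        ... | no _  = let (i , e) = p⊆ f q in suc i , e
    ... | p , p⊆ , ∂p = p , p⊆ , λ x → trans (∂p x) (cong₂ (λ a b → δ a x xor δ b x) (start P) (end P))

module BridgePaths (G : Graph) (connected : Connected (whole G)) (no-cut : NoCutpoint (whole G))
                   (C : Subgraph G) (circle : IsCircle C) where
  open Graph G
  open Incidence G
  open Circles G
  open Contraction G C circle
  open Bridges G connected no-cut C circle
  open Components G connected no-cut C circle
  open Equivalence

  -- All interior vertices of the path are off C, so X is even there and contains both or neither of
  -- the two path edges meeting at each. Being nonempty, X then contains the whole path. A chord is
  -- a single edge.
  path-bridge-minimal : ∀ {B X} → IsBridge C B → IsPath B → Circuit quotient X → X ⊆ᶠ lookup (E B) → lookup (E B) ⊆ᶠ X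
  path-bridge-minimal {B} {X} (chord {e} _ _ _ _ (_ , _ , E≡)) _ (_ , (x , xx) , _) X⊆B f f∈ =
    subst (λ f → X f ≡ true) (trans (only (X⊆B x xx)) (sym (only f∈))) xx
    where
    only : ∀ {f} → lookup (E B) f ≡ true → f ≡ e
    only f∈ = x∈⁅y⁆⇒x≡y e (subst (_ ∈_) E≡ (≡⇒∈ f∈))
  path-bridge-minimal {B} {X} (component {D} isC E⇔ _) (zero , v , η , inj , joins , V-path , E-path) cX X⊆B f f∈
    with to (E-path f) (≡⇒∈ f∈)
  ... | () , _
  path-bridge-minimal {B} {X} (component {D} isC E⇔ _) (suc k , v , η , inj , joins , V-path , E-path) cX@(mX , (x , xx) , _) X⊆B f f∈
    with to (E-path f) (≡⇒∈ f∈) | to (E-path x) (≡⇒∈ (X⊆B x xx))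
  ... | i , refl | j , refl = trans (trans (constant i) (sym (constant j))) xx
    where
    open ComponentBridge {D} {B} isC E⇔
    incident-index : ∀ {i m} → Incident (η i) (v m) → m ≡ inject₁ i ⊎ m ≡ suc i
    incident-index {i} at with joins-unique {η i} (joins i) at
    ... | inj₁ p = inj₁ (inj p)
    ... | inj₂ p = inj₂ (inj p)

    module AtC (j : Fin k) (m∈ : v (suc (inject₁ j)) ∈ V C) where
      inner : ∀ {i y} → Joins (η i) (v (suc (inject₁ j))) y → y ∈ V D
      inner {i} {y} jn with to (E⇔ (η i)) (from (E-path (η i)) (i , refl))
      ... | inj₁ q = ⊥-elim (D∉C (incident-∈V D q (joins⇒incident {η i} jn)) m∈)
      ... | inj₂ (a , b , a∈ , b∈ , jn′) with joins-unique {η i} jn (joins⇒incident {η i} jn′)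
      ...   | inj₁ refl = ⊥-elim (D∉C a∈ m∈)
      ...   | inj₂ refl = a∈
      left : v (inject₁ (inject₁ j)) ∈ V D
      left = inner {inject₁ j} (joins-sym {η (inject₁ j)} (joins (inject₁ j)))
      right : v (suc (suc j)) ∈ V D
      right = inner {suc j} (joins (suc j))
      bounded : ∀ {i′ w} → w ∉ V C → toℕ i′ ≤ toℕ j → w ≡ v (inject₁ i′) ⊎ w ≡ v (suc i′) → ∃[ l ] v l ≡ w × toℕ l ≤ toℕ j
      bounded {i′} _ i′≤j (inj₁ refl) = inject₁ i′ , refl , subst (_≤ toℕ j) (sym (toℕ-inject₁ i′)) i′≤j
      bounded {i′} w∉ i′≤j (inj₂ refl) = suc i′ , refl , ℕ.≤∧≢⇒< i′≤j λ i′≡j →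
        w∉ (subst (λ i → v (suc i) ∈ V C) (sym (toℕ-injective (trans i′≡j (sym (toℕ-inject₁ j))))) m∈)
      along : ∀ {x y} → Reachable D x y → ∀ i → v i ≡ x → toℕ i ≤ toℕ j → ∃[ l ] v l ≡ y × toℕ l ≤ toℕ j
      along ε i vi i≤j = i , vi , i≤j
      along {x} (_◅_ {j = w} (f , f∈ , jn) r) i vi i≤j with to (E-path f) (from (E⇔ f) (inj₁ f∈))
      ... | i′ , refl with bounded {i′} (D∉C (incident-∈V D f∈ (joins⇒incident (joins-sym {f} jn))))
                             (i′≤j (incident-index (subst (Incident f) (sym vi) (joins⇒incident {f} jn))))
                             (joins-unique {f} (joins i′) (joins⇒incident (joins-sym {f} jn)))
        where
        i′≤j : i ≡ inject₁ i′ ⊎ i ≡ suc i′ → toℕ i′ ≤ toℕ j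
        i′≤j (inj₁ refl) = subst (_≤ toℕ j) (toℕ-inject₁ i′) i≤j
        i′≤j (inj₂ refl) = ℕ.<⇒≤ i≤j
      ... | l , vl , l≤j = along r l vl l≤j

    -- A walk in D from an earlier vertex of the path cannot pass an interior vertex of the path on C.
    interior : ∀ j → v (suc (inject₁ j)) ∉ V C
    interior j m∈ with AtC.along j m∈ (proj₂ (proj₁ (proj₂ isC)) (AtC.left j m∈) (AtC.right j m∈)) (inject₁ (inject₁ j)) refl
                         (ℕ.≤-reflexive (trans (toℕ-inject₁ (inject₁ j)) (toℕ-inject₁ j)))
    ... | l , vl≡ , l≤j with inj vl≡
    ...   | refl = ℕ.<⇒≱ (ℕ.n<1+n (toℕ j)) (ℕ.≤-trans (ℕ.n≤1+n _) l≤j)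
    step : ∀ j → X (η (inject₁ j)) ≡ X (η (suc j))
    step j = iff (λ xg → pair-at {X} {m} {η (inject₁ j)} {η (suc j)} ∂m xg (inc-true {η (inject₁ j)} jg (≢ (inject₁≢suc (inject₁ j)) ∘ sym))
                   λ f xf i → swap (only f xf i))
                 (λ xh → pair-at {X} {m} {η (suc j)} {η (inject₁ j)} ∂m xh (inc-true {η (suc j)} jh (≢ (inject₁≢suc (suc j)))) only)
      where
      m = v (suc (inject₁ j))
      ∂m : ∂ X m ≡ false
      ∂m = proj₂ mX m (∉⇒≡ (interior j))
      jg : Joins (η (inject₁ j)) m (v (inject₁ (inject₁ j)))
      jg = joins-sym {η (inject₁ j)} (joins (inject₁ j))
      jh : Joins (η (suc j)) m (v (suc (suc j)))
      jh = joins (suc j)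
      ≢ : ∀ {a b} → a ≢ b → v a ≢ v b
      ≢ a≢b p = a≢b (inj p)
      only : ∀ f → X f ≡ true → Incident f m → f ≡ η (suc j) ⊎ f ≡ η (inject₁ j)
      only f xf i with to (E-path f) (≡⇒∈ (X⊆B f xf))
      ... | i′ , refl with incident-index {i′} i
      ...   | inj₁ p = inj₁ (cong η (sym (inject₁-injective p)))
      ...   | inj₂ p = inj₂ (cong η (sym (suc-injective p)))
      iff : ∀ {a b} → (a ≡ true → b ≡ true) → (b ≡ true → a ≡ true) → a ≡ b
      iff {true}  {true}  _ _ = refl
      iff {false} {false} _ _ = refl
      iff {true}  {false} p _ = sym (p refl)
      iff {false} {true}  _ q = q refl

    constant : ∀ i → X (η i) ≡ X (η zero)
    constant = step-constant (X ∘ η) step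

  -- A simple path in B between two attachments on C is a nonempty cycle of G / C inside the circuit
  -- X, hence equal to X. So it uses every edge of B.
  minimal-bridge-path : ∀ {B X} → IsBridge C B → Circuit quotient X → lookup (E B) ⊆ᶠ X → IsPath B
  minimal-bridge-path {B} {X} (chord {e} {u} {v} _ u≢v _ _ (j , V≡ , E≡)) _ _ =
    1 , vertex , (λ _ → e) , inj , (λ { zero → j }) , (λ x → mk⇔ V⁻ V⁺) ,
    λ f → mk⇔ (λ f∈ → zero , sym (x∈⁅y⁆⇒x≡y e (subst (f ∈_) E≡ f∈))) (λ { (_ , refl) → subst (e ∈_) (sym E≡) (x∈⁅x⁆ e) })
    where
    vertex : Fin 2 → Vertex
    vertex zero       = u
    vertex (suc zero) = v
    inj : Injective _≡_ _≡_ vertex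
    inj {zero}     {zero}     _ = refl
    inj {zero}     {suc zero} p = ⊥-elim (u≢v p)
    inj {suc zero} {zero}     p = ⊥-elim (u≢v (sym p))
    inj {suc zero} {suc zero} _ = refl
    V⁻ : ∀ {x} → x ∈ V B → ∃[ i ] vertex i ≡ x
    V⁻ x∈ with x∈p∪q⁻ ⁅ u ⁆ ⁅ v ⁆ (subst (_ ∈_) V≡ x∈)
    ... | inj₁ p = zero , sym (x∈⁅y⁆⇒x≡y u p)
    ... | inj₂ p = suc zero , sym (x∈⁅y⁆⇒x≡y v p)
    V⁺ : ∀ {x} → ∃[ i ] vertex i ≡ x → x ∈ V B
    V⁺ (zero , refl)     = subst (u ∈_) (sym V≡) (x∈p∪q⁺ (inj₁ (x∈⁅x⁆ u)))
    V⁺ (suc zero , refl) = subst (v ∈_) (sym V≡) (x∈p∪q⁺ (inj₂ (x∈⁅x⁆ v)))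
  minimal-bridge-path {B} {X} (component {D} isC E⇔ V⇔) cX B⊆X =
    length , vertex , edge , injective , joins , (λ x → mk⇔ V⁻ V⁺) ,
    λ f → mk⇔ E⁻ λ { (i , refl) → edge∈ i }
    where
    open ComponentBridge {D} {B} isC E⇔
    open Attachments attachments
    open SimplePaths B
    D⊑B : D ⊑ B
    D⊑B = (λ v∈ → from (V⇔ _) (inj₁ v∈)) , λ f∈ → from (E⇔ _) (inj₁ f∈)
    P : SimplePath a b
    P = simplePath ((f₁ , f₁∈ , j₁) ◅ (reachable-mono {a} {D} {B} D⊑B (proj₂ (proj₁ (proj₂ isC)) x₁∈ x₂∈)
                      ◅◅ ((f₂ , f₂∈ , joins-sym {f₂} j₂) ◅ ε)))
    open SimplePath P
    p = proj₁ (edge-set P)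
    p⊆ = proj₁ (proj₂ (edge-set P))
    ∂p = proj₂ (proj₂ (edge-set P))
    p⊆B : ∀ f → p f ≡ true → f ∈ E B
    p⊆B f pf with p⊆ f pf
    ... | i , refl = edge∈ i
    p∈ : Subspace.Mem quotient p
    p∈ = (λ f c → Bool.¬-not λ pf → off (p⊆B f pf) (≡⇒∈ c)) , λ v c →
      trans (∂p v) (cong₂ _xor_ (δ-≢ {i = a} λ { refl → ≡⇒∉ c a∈ }) (δ-≢ {i = b} λ { refl → ≡⇒∉ c b∈ }))
    p≗X : p ≗ X
    p≗X with any? (λ f → p f Bool.≟ true)
    ... | yes (f , pf) = circuit-≗ quotient {i = f} cX p∈ (λ f pf → B⊆X f (∈⇒≡ (p⊆B f pf))) pf
    ... | no ¬p = absurdᵇ (trans (∂p a) (cong₂ _xor_ (δ-refl a) (δ-≢ (a≢b ∘ sym))))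
                    (trans (∂-cong (λ f → Bool.¬-not λ pf → ¬p (f , pf)) a) (∂-∅ a))
    E⁻ : ∀ {f} → f ∈ E B → ∃[ i ] edge i ≡ f
    E⁻ {f} f∈ = p⊆ f (trans (p≗X f) (B⊆X f (∈⇒≡ f∈)))
    incident⁻ : ∀ {f x} → f ∈ E B → Incident f x → ∃[ i ] vertex i ≡ x
    incident⁻ {f} f∈ at with E⁻ f∈
    ... | i , refl with joins-unique {f} (joins i) at
    ...   | inj₁ q = inject₁ i , sym q
    ...   | inj₂ q = suc i , sym q
    V⁻ : ∀ {x} → x ∈ V B → ∃[ i ] vertex i ≡ x
    V⁻ {x} x∈ with to (V⇔ x) x∈
    ... | inj₂ (f , j , at) = incident⁻ (from (E⇔ f) (inj₂ j)) at
    -- Any edge at x suffices, and the walk from x to a begins with one, since x is off C and a is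
    -- on it.
    ... | inj₁ x∈D with proj₂ connected {x} {a} ∈⊤ ∈⊤
    ...   | ε = ⊥-elim (D∉C x∈D a∈)
    ...   | (f , _ , jn) ◅ _ = incident⁻ (at-inner {f} x∈D (joins⇒incident {f} jn)) (joins⇒incident {f} jn)
    V⁺ : ∀ {x} → ∃[ i ] vertex i ≡ x → x ∈ V B
    V⁺ (i , refl) = on-edge length edge vertex joins edge∈ (nonzero length vertex start end) i
      where
      nonzero : ∀ k (v : Fin (suc k) → Vertex) → v zero ≡ a → v (fromℕ k) ≡ b → k ≢ 0
      nonzero zero v p q _ = a≢b (trans (sym p) q)
      on-edge : ∀ k (η : Fin k → Edge) (v : Fin (suc k) → Vertex) → (∀ i → Joins (η i) (v (inject₁ i)) (v (suc i))) →
        (∀ i → η i ∈ E B) → k ≢ 0 → ∀ i → v i ∈ V B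
      on-edge zero η v js e∈ k≢0 i = ⊥-elim (k≢0 refl)
      on-edge (suc k) η v js e∈ k≢0 zero    = incident-∈V B (e∈ zero) (joins⇒incident {η zero} (js zero))
      on-edge (suc k) η v js e∈ k≢0 (suc i) = incident-∈V B (e∈ i) (joins⇒incident (joins-sym {η i} (js i)))

-- Ears and batteries

module MainProof (Γ : SignedGraph) (block : IsBlock (whole (SignedGraph.graph Γ)))
            (e : SignedGraph.Edge Γ) (C : Subgraph (SignedGraph.graph Γ)) (battery : IsPositiveBatteryIn Γ e C) where
  open SignedGraph Γ
  open Incidence graph
  open Circles graph
  open Signs Γ

  circleC : IsCircle C
  circleC = proj₁ (proj₁ battery)

  open Contraction graph C circleC
  open Bridges graph (proj₁ block) (proj₁ (proj₂ block)) C circleC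
  open Components graph (proj₁ block) (proj₁ (proj₂ block)) C circleC
  open BridgePaths graph (proj₁ block) (proj₁ (proj₂ block)) C circleC

  spanned-positive : ∀ {O} → Circuit cycles O → s O ≡ ⊹ → IsPositiveCircle Γ (spanned O)
  spanned-positive {O} cO sO = circuit⇒circle cO , trans (s-cong (lookup∘tabulate O)) sO

  𝓜 : BatteryMatroid size
  𝓜 = record
    { Z = cycles ; Z/C = quotient ; s = s ; s-⊕ = s-⊕ ; s-cong = s-cong ; C = lookup (E C) ; e = e
    ; C-circuit = circle⇒circuit {C} circleC
    ; e∈C       = ∈⇒≡ (proj₁ (proj₂ battery))
    ; sC        = proj₂ (proj₁ battery)
    ; unique    = λ {O} cO oe sO f → trans (sym (lookup∘tabulate O f))
                    (cong (λ S → lookup S f) (proj₂ (proj₂ (proj₂ battery) (spanned O) (spanned-positive cO sO) (spanned-∈E oe))))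
    ; off-C     = proj₁
    ; project   = quotient-project
    ; lift      = quotient-lift
    }

  open Battery 𝓜
  open BridgeSet

  -- The circuit through the corner shares f with X and leaves X by g, which is the starting
  -- position of `theta`.
  theta-at-corner : ∀ {X w f g} → Circuit quotient X → w ∉ V C → Incident f w → Incident g w →
    X f ≡ true → X g ≡ false → ∃[ Y ] Circuit quotient Y × Circuit quotient (X ⊕ Y)
      × (∃[ i ] X i ≡ true × Y i ≡ true) × Y g ≡ true
  theta-at-corner {X} {w} {f} {g} cX w∉ i j xf xg with circuit-through-corner {w} {f} {g} w∉ i j (λ { refl → absurdᵇ xf xg })
  ... | Y , cY , yf , yg = theta quotient {X} {Y} {f} {g} cX cY xf yf xg yg

  -- If X misses g, both other circuits of the theta at this corner contain g, and one of them is an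
  -- ear.
  ear-spreads : Spreads (λ f → ∃[ X ] Ear X × X f ≡ true)
  ear-spreads {w} {f} {g} w∉ i j (X , eX , xf) with X g in xg
  ... | true  = X , eX , xg
  ... | false with theta-at-corner {X} (proj₁ eX) w∉ i j xf xg
  ...   | Y , cY , cW , _ , yg with theta-ear (proj₂ eX) cY cW
  ...     | inj₁ eY = Y , eY , yg
  ...     | inj₂ eW = X ⊕ Y , eW , cong₂ _xor_ xg yg

  some-ear : ∀ {D} → BridgeSet D → ∃[ X ] Ear X × X ⊆ᶠ D
  some-ear 𝓓 with open-arc 𝓓
  ... | p , p⊆D , p∈ , p∉ with circuitOutside quotient cycles p∈ p∉
  ...   | X , cX , X⊆p , X∉ = X , (cX , X∉) , λ f xf → p⊆D f (X⊆p f xf)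

  ear-through : ∀ {D f} → BridgeSet D → D f ≡ true → ∃[ X ] Ear X × X ⊆ᶠ D × X f ≡ true
  ear-through {D} {f} 𝓓 df with some-ear 𝓓
  ... | X , eX@((_ , (x , xx) , _) , _) , X⊆D with linked 𝓓 {K = λ f → ∃[ X ] Ear X × X f ≡ true} ear-spreads (X⊆D x xx) df (X , eX , xx)
  ...   | Y , eY , yf = Y , eY , circuit-⊆ 𝓓 {f = f} (proj₁ eY) yf df , yf

  Disjoint : 𝔽 size → 𝔽 size → Set
  Disjoint D D′ = ∀ f → D f ≡ true → D′ f ≡ false

  -- The part of W in each bridge is again a cycle of G / C and lies inside the circuit X or Y, so
  -- it is empty or all of it.
  separated : ∀ {D D′ X Y} → BridgeSet D → BridgeSet D′ → Disjoint D D′ →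
    Circuit quotient X → X ⊆ᶠ D → Circuit quotient Y → Y ⊆ᶠ D′ → Separated X Y
  separated {D} {D′} {X} {Y} 𝓓 𝓓′ dis cX X⊆D cY Y⊆D′ = record
    { disjoint = λ i xi → ⊆-∨-false Y⊆D′ i (dis i (X⊆D i xi))
    ; parts    = λ W mW W⊆ → combine W (split W W⊆)
        (proj₂ (proj₂ cX) (λ f → W f ∧ D f) (restrict 𝓓 mW) (in-X W W⊆))
        (proj₂ (proj₂ cY) (λ f → W f ∧ D′ f) (restrict 𝓓′ mW) (in-Y W W⊆))
    }
    where
    in-X : ∀ W → (∀ i → W i ≡ true → X i ≡ true ⊎ Y i ≡ true) → (λ f → W f ∧ D f) ⊆ᶠ X
    in-X W W⊆ i p with W⊆ i (Bool.∧-conicalˡ (W i) _ p)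
    ... | inj₁ x = x
    ... | inj₂ y = absurdᵇ (Y⊆D′ i y) (dis i (Bool.∧-conicalʳ (W i) _ p))
    in-Y : ∀ W → (∀ i → W i ≡ true → X i ≡ true ⊎ Y i ≡ true) → (λ f → W f ∧ D′ f) ⊆ᶠ Y
    in-Y W W⊆ i p with W⊆ i (Bool.∧-conicalˡ (W i) _ p)
    ... | inj₁ x = absurdᵇ (Bool.∧-conicalʳ (W i) _ p) (dis i (X⊆D i x))
    ... | inj₂ y = y
    split : ∀ W → (∀ i → W i ≡ true → X i ≡ true ⊎ Y i ≡ true) → ∀ i → W i ≡ (W i ∧ D i) xor (W i ∧ D′ i)
    split W W⊆ i = at (W i) (W⊆ i)
      where
      at : ∀ w → (w ≡ true → X i ≡ true ⊎ Y i ≡ true) → w ≡ (w ∧ D i) xor (w ∧ D′ i)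
      at false _ = refl
      at true  q with q refl
      ... | inj₁ x = sym (cong₂ _xor_ (X⊆D i x) (dis i (X⊆D i x)))
      ... | inj₂ y = sym (cong₂ _xor_ (Bool.¬-not λ d → absurdᵇ (Y⊆D′ i y) (dis i d)) (Y⊆D′ i y))
    combine : ∀ W → (∀ i → W i ≡ (W i ∧ D i) xor (W i ∧ D′ i)) →
      (λ f → W f ∧ D f) ≗ ∅ ⊎ (λ f → W f ∧ D f) ≗ X → (λ f → W f ∧ D′ f) ≗ ∅ ⊎ (λ f → W f ∧ D′ f) ≗ Y →
      W ≗ ∅ ⊎ W ≗ X ⊎ W ≗ Y ⊎ W ≗ X ⊕ Y
    combine W eq (inj₁ p) (inj₁ q) = inj₁ λ i → trans (eq i) (cong₂ _xor_ (p i) (q i))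
    combine W eq (inj₂ p) (inj₁ q) = inj₂ (inj₁ λ i → trans (eq i) (trans (cong₂ _xor_ (p i) (q i)) (Bool.xor-identityʳ (X i))))
    combine W eq (inj₁ p) (inj₂ q) = inj₂ (inj₂ (inj₁ λ i → trans (eq i) (cong₂ _xor_ (p i) (q i))))
    combine W eq (inj₂ p) (inj₂ q) = inj₂ (inj₂ (inj₂ λ i → trans (eq i) (cong₂ _xor_ (p i) (q i))))

  -- Membership in X spreads through D: a corner where it failed would give a theta, which
  -- `no-theta` forbids. The edge f may lie in either ear, so one battery controls both bridges.
  ear-fills : ∀ {D D′ X Y f} → BridgeSet D → BridgeSet D′ → Disjoint D D′ → Ear X → X ⊆ᶠ D → Ear Y → Y ⊆ᶠ D′ →
    X f ≡ true ⊎ Y f ≡ true → UniquelyPositive f → D ⊆ᶠ X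
  ear-fills {D} {D′} {X} {Y} 𝓓 𝓓′ dis eX X⊆D eY Y⊆D′ f∈ uniq g dg =
    linked 𝓓 {K = λ f → X f ≡ true} spreads (X⊆D x xx) dg xx
    where
    x = proj₁ (proj₁ (proj₂ (proj₁ eX)))
    xx = proj₂ (proj₁ (proj₂ (proj₁ eX)))
    spreads : Spreads (λ f → X f ≡ true)
    spreads {w} {f} {g} w∉ i j xf with X g in xg
    ... | true  = refl
    ... | false with theta-at-corner {X} (proj₁ eX) w∉ i j xf xg
    ...   | X′ , cX′ , cW , (h , xh , x′h) , _ =
      ⊥-elim (no-theta eX cX′ cW eY (sep (proj₁ eX) X⊆D) (sep cX′ X′⊆D) (sep cW W⊆D) f∈ uniq)
      where
      sep : ∀ {X} → Circuit quotient X → X ⊆ᶠ D → Separated X Y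
      sep cX X⊆ = separated 𝓓 𝓓′ dis cX X⊆ (proj₁ eY) Y⊆D′
      -- The reason why `theta` also returns a common element: a circuit that meets X at h stays in
      -- the bridge of X.
      X′⊆D : X′ ⊆ᶠ D
      X′⊆D = circuit-⊆ 𝓓 {f = h} cX′ x′h (X⊆D h xh)
      W⊆D : X ⊕ X′ ⊆ᶠ D
      W⊆D k p with X k in xk
      ... | true  = X⊆D k xk
      ... | false = X′⊆D k p

  uniquelyPositive : ∀ {f} → IsPositiveBattery Γ f → UniquelyPositive f
  uniquelyPositive {f} (P , _ , _ , uniq) {O} {O′} pO pO′ of o′f g = trans (to-P pO of) (sym (to-P pO′ o′f))
    where
    to-P : ∀ {O} → PositiveCircuit O → O f ≡ true → O g ≡ lookup (E P) g
    to-P {O} (cO , sO) of = trans (sym (lookup∘tabulate O g))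
      (cong (λ S → lookup S g) (proj₂ (uniq (spanned O) (spanned-positive cO sO) (spanned-∈E of))))

  -- One ear is chosen through f, in whichever bridge holds it, and any ear in the other. Since f
  -- may be on either side, exchanging D and D′ yields the second bridge too.
  battery⇒path : ∀ {D D′ f} → IsBridge C D → IsBridge C D′ → ¬ (D ≐ D′) → f ∈ E D ⊎ f ∈ E D′ → IsPositiveBattery Γ f → IsPath D
  battery⇒path {D} {D′} {f} b b′ D≢D′ f∈ pb = go f∈
    where
    𝓓 = bridge-set b
    𝓓′ = bridge-set b′
    dis : Disjoint (lookup (E D)) (lookup (E D′))
    dis g d = Bool.¬-not λ d′ → D≢D′ (bridges-meet b b′ (≡⇒∈ d) (≡⇒∈ d′))
    go : f ∈ E D ⊎ f ∈ E D′ → IsPath D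
    go (inj₁ f∈) with ear-through 𝓓 (∈⇒≡ f∈) | some-ear 𝓓′
    ... | X , eX , X⊆D , xf | Y , eY , Y⊆D′ =
      minimal-bridge-path b (proj₁ eX) (ear-fills 𝓓 𝓓′ dis eX X⊆D eY Y⊆D′ (inj₁ xf) (uniquelyPositive pb))
    go (inj₂ f∈) with some-ear 𝓓 | ear-through 𝓓′ (∈⇒≡ f∈)
    ... | X , eX , X⊆D | Y , eY , Y⊆D′ , yf =
      minimal-bridge-path b (proj₁ eX) (ear-fills 𝓓 𝓓′ dis eX X⊆D eY Y⊆D′ (inj₂ yf) (uniquelyPositive pb))

  -- Both bridges are then single ears X and Y. As there are no other bridges, every cycle of G / C
  -- is ∅, X, Y or X ⊕ Y, which is the hypothesis of `joined-unique`.
  paths⇒battery : ∀ {D D′} → HasExactlyTwoBridges C D D′ → IsPath D → IsPath D′ → ∀ {f} → f ∈ E D ⊎ f ∈ E D′ → IsPositiveBattery Γ f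
  paths⇒battery {D} {D′} (b , b′ , D≢D′ , only) path path′ {f} f∈ with some-ear (bridge-set b) | some-ear (bridge-set b′)
  ... | X , eX , X⊆D | Y , eY , Y⊆D′ = spanned N , spanned-positive (proj₁ pN) (proj₂ pN) , spanned-∈E Nf , uniq
    where
    dis : Disjoint (lookup (E D)) (lookup (E D′))
    dis g d = Bool.¬-not λ d′ → D≢D′ (bridges-meet b b′ (≡⇒∈ d) (≡⇒∈ d′))
    D⊆X = path-bridge-minimal b path (proj₁ eX) X⊆D
    D′⊆Y = path-bridge-minimal b′ path′ (proj₁ eY) Y⊆D′
    sep = separated (bridge-set b) (bridge-set b′) dis (proj₁ eX) X⊆D (proj₁ eY) Y⊆D′
    LX = liftOf (proj₁ (proj₁ eX))
    LY = liftOf (proj₁ (proj₁ eY))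
    N = Lift.T LX ⊕ Lift.T LY
    pN : PositiveCircuit N
    pN = joined eX eY sep LX LY
    f∈XY : X f ≡ true ⊎ Y f ≡ true
    f∈XY = Sum.map (λ p → D⊆X f (∈⇒≡ p)) (λ p → D′⊆Y f (∈⇒≡ p)) f∈
    f∉C : lookup (E C) f ≡ false
    f∉C with f∈XY
    ... | inj₁ p = ∈⇒∉C (proj₁ (proj₁ eX)) p
    ... | inj₂ p = ∈⇒∉C (proj₁ (proj₁ eY)) p
    Nf : N f ≡ true
    Nf = joined-∋ (proj₁ (proj₁ eX)) (proj₁ (proj₁ eY)) sep LX LY f∈XY
    covered : ∀ W → Subspace.Mem quotient W → ∀ i → W i ≡ true → X i ≡ true ⊎ Y i ≡ true
    covered W mW i wi with bridge-of i (≡⇒∉ (∈⇒∉C mW wi))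
    ... | B , bB , i∈ with only B bB
    ...   | inj₁ (_ , refl) = inj₁ (D⊆X i (∈⇒≡ i∈))
    ...   | inj₂ (_ , refl) = inj₂ (D′⊆Y i (∈⇒≡ i∈))
    uniq : ∀ C′ → IsPositiveCircle Γ C′ → f ∈ E C′ → C′ ≐ spanned N
    uniq C′ (cC′ , sC′) f∈C′ = circle-≐ {C′} {spanned N} cC′ (circuit⇒circle (proj₁ pN)) λ g →
      trans (joined-unique eX eY LX LY (λ W mW → Separated.parts sep W mW (covered W mW))
              (circle⇒circuit {C′} cC′ , sC′) (∈⇒≡ f∈C′) f∉C g) (sym (lookup∘tabulate N g))

mainTheorem7 : (Γ : SignedGraph) → let open SignedGraph Γ in
    IsBlock (whole graph) →
    ¬ IsSingleEdge (whole graph) →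
    ¬ IsCircle (whole graph) →
    (e : Edge) (C : Subgraph graph) →
    IsPositiveBatteryIn Γ e C →
    (D₁ D₂ : Subgraph graph) →
    HasExactlyTwoBridges C D₁ D₂ →
    ((IsPath D₁ × IsPath D₂) →
    ∀ f → f ∈ E D₁ ∪ E D₂ → IsPositiveBattery Γ f)
    × (¬ (IsPath D₁ × IsPath D₂) →
    ∀ f → f ∈ E D₁ ∪ E D₂ → ¬ IsPositiveBattery Γ f)
mainTheorem7 Γ block _ _ e C battery D₁ D₂ two@(b₁ , b₂ , D₁≢D₂ , _) =
  (λ (path₁ , path₂) f f∈ → paths⇒battery two path₁ path₂ (x∈p∪q⁻ (E D₁) (E D₂) f∈)) ,
  λ ¬paths f f∈ pb → ¬paths (battery⇒path b₁ b₂ D₁≢D₂ (x∈p∪q⁻ (E D₁) (E D₂) f∈) pb ,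
                             battery⇒path b₂ b₁ (D₁≢D₂ ∘ ≐-sym) (swap (x∈p∪q⁻ (E D₁) (E D₂) f∈)) pb)
  where
  open MainProof Γ block e C battery
  ≐-sym : D₂ ≐ D₁ → D₁ ≐ D₂
  ≐-sym (p , q) = sym p , sym q
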